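{- Let $u=[1][2][3][4]\in D_4$ and let $I=[e,u]$ be the closed interval between the identity $e$ and $u$ in the absolute order $\mathrm{Abs}(D_4)$. Then the Hasse diagram of the open interval $(e,u)$ is disconnected, and therefore $I$ is not Cohen-Macaulay over any field. Moreover, for every $n\ge4$ the poset $\mathrm{Abs}(D_n)$ is not Cohen-Macaulay over any field.
   Context: $B_n$ is the group of permutations $w$ of $\{\pm1,\dots,\pm n\}$ with $w(-i)=-w(i)$ for all $i$. For $a_1,\dots,a_k\in\{\pm1,\dots,\pm n\}$ with pairwise distinct absolute values, the paired $k$-cycle $(\!(a_1,\dots,a_k)\!)$ is the permutation with cycle form $(a_1\,a_2\cdots a_k)(-a_1\,-a_2\cdots -a_k)$, and the balanced $k$-cycle $[a_1,\dots,a_k]$ is the permutation with cycle form $(a_1\,a_2\cdots a_k\,-a_1\,-a_2\cdots -a_k)$. In particular $[i]$ exchanges $i$ and $-i$ and fixes all else. The Coxeter group $D_n$ is the subgroup of $B_n$ generated by the set $\mathcal T=\{(\!(i,j)\!),(\!(i,-j)\!):1\le i<j\le n\}$, which is the set of all reflections of $D_n$; equivalently, $D_n$ consists of the $w\in B_n$ with an even number of balanced cycles. Absolute order: for $w\in D_n$, the absolute length $\ell_{\mathcal T}(w)$ is the least $k$ such that $w$ is a product of $k$ elements of $\mathcal T$; $\mathrm{Abs}(D_n)$ is the partial order on $D_n$ given by $u\preceq v$ iff $\ell_{\mathcal T}(u)+\ell_{\mathcal T}(u^{ -1}v)=\ell_{\mathcal T}(v)$. A finite poset $P$ is Cohen-Macaulay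 over a field $k$ if its order complex $\Delta(P)$ (the simplicial complex of chains of $P$) is, i.e. for every face $F$ of $\Delta(P)$, including $F=\varnothing$, the reduced simplicial homology $\tilde H_i(\mathrm{link}_{\Delta(P)}(F);k)$ vanishes for all $i<\dim \mathrm{link}_{\Delta(P)}(F)$. -}

module Defs where

open import Algebra.Apartness.Bundles using (HeytingField; HeytingCommutativeRing)
open import Algebra.Bundles using (Group; CommutativeRing; Semiring)
import Algebra.Definitions.RawSemiring as RawSemiringDefs
import Algebra.Properties.Group as GroupProperties
open import Data.Empty using (⊥-elim)
open import Data.Fin using (Fin; zero; suc; toℕ; punchIn)
import Data.Fin as Fin
import Data.Fin.Properties as Fin
open import Data.Fin.Permutation.Components using (transpose)
open import Data.List using (List; _++_; tabulate)
import Data.List.Membership.Setoid as Membership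
import Data.List.Membership.Setoid.Properties as Membershipₚ
import Data.List.Relation.Binary.Disjoint.Setoid as ListDisjoint
import Data.List.Relation.Binary.Subset.Setoid as ListSubset
open import Data.Nat using (ℕ; zero; suc; _+_; _≤_; _<_; z≤n; s≤s)
open import Data.Nat.Properties
  using (≤-antisym; ≤-reflexive; ≤-trans; +-monoʳ-≤;
         +-cancelˡ-≡; +-assoc; +-identityʳ; m+n≡0⇒m≡0)
open import Data.Product using (Σ-syntax; ∃; ∃₂; _×_; _,_; proj₁; proj₂)
open import Data.Product.Properties using (≡-dec)
open import Data.Sign using (Sign; opposite)
import Data.Sign.Properties as Sign
open import Data.Sum using (_⊎_; inj₁; inj₂)
open import Data.Unit.Polymorphic using (⊤)
open import Data.Vec using (Vec; []; _∷_)
import Data.Vec as Vec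
open import Data.Vec.Functional using (foldr)
open import Function using (_∘_; Injective; _↔_; Inverse; mk↔ₛ′)
open import Function.Construct.Composition using (_↔-∘_)
open import Function.Construct.Identity using (↔-id)
open import Function.Construct.Symmetry using (↔-sym)
open import Level using (Level; 0ℓ; _⊔_) renaming (suc to lsuc)
open import Relation.Binary.Bundles using (Setoid; Poset)
open import Relation.Binary.Core using (Rel)
open import Relation.Binary.Definitions using (DecidableEquality)
open import Relation.Binary.Construct.Closure.Equivalence using (EqClosure)
import Relation.Binary.Construct.On as On
import Relation.Binary.Properties.Poset as PosetProperties
open import Relation.Binary.PropositionalEquality
  using (_≡_; _≢_; refl; sym; trans; cong; subst; module ≡-Reasoning)
open import Relation.Nullary using (¬_; Dec; yes; no)
open import Relation.Nullary.Decidable using (map′; _×-dec_; from-yes)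

private variable
  a ℓ ℓ₁ ℓ₂ f : Level

-- The set {±1,…,±n}; (s , i) stands for s·(i+1).
Signed : ℕ → Set
Signed n = Sign × Fin n

neg : ∀ {n} → Signed n → Signed n
neg (s , i) = opposite s , i

infix 4 _≟ₛ_
_≟ₛ_ : ∀ {n} → DecidableEquality (Signed n)
_≟ₛ_ = ≡-dec Sign._≟_ Fin._≟_

record SignedPerm (n : ℕ) : Set where
  no-eta-equality
  field
    perm : Signed n ↔ Signed n
    odd  : ∀ x → Inverse.to perm (neg x) ≡ neg (Inverse.to perm x)

  infixr 9 _$_
  _$_ : Signed n → Signed n
  _$_ = Inverse.to perm

  _$⁻¹_ : Signed n → Signed n
  _$⁻¹_ = Inverse.from perm

open SignedPerm public

neg-involutive : ∀ {n} (x : Signed n) → neg (neg x) ≡ x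
neg-involutive (s , i) = cong (_, i) (Sign.opposite-selfInverse refl)

neg≢ : ∀ {n} (x : Signed n) → neg x ≢ x
neg≢ (Sign.- , i) ()
neg≢ (Sign.+ , i) ()

module _ {n : ℕ} where

  $-$⁻¹ : ∀ (w : SignedPerm n) x → w $ (w $⁻¹ x) ≡ x
  $-$⁻¹ w = Inverse.strictlyInverseˡ (perm w)

  $⁻¹-$ : ∀ (w : SignedPerm n) x → w $⁻¹ (w $ x) ≡ x
  $⁻¹-$ w = Inverse.strictlyInverseʳ (perm w)

  infix 4 _≈ᴮ_
  record _≈ᴮ_ (v w : SignedPerm n) : Set where
    constructor pointwise
    field at : ∀ x → v $ x ≡ w $ x
  open _≈ᴮ_ public

  infixr 7 _∙ᴮ_
  _∙ᴮ_ : SignedPerm n → SignedPerm n → SignedPerm n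
  perm (v ∙ᴮ w)   = perm v ↔-∘ perm w
  odd  (v ∙ᴮ w) x = trans (cong (v $_) (odd w x)) (odd v (w $ x))

  εᴮ : SignedPerm n
  perm εᴮ   = ↔-id _
  odd  εᴮ _ = refl

  infix 8 _⁻¹ᴮ
  _⁻¹ᴮ : SignedPerm n → SignedPerm n
  perm (w ⁻¹ᴮ)   = ↔-sym (perm w)
  odd  (w ⁻¹ᴮ) x = trans
    (cong (λ y → w $⁻¹ neg y) (sym ($-$⁻¹ w x)))
    (trans (cong (w $⁻¹_) (sym (odd w _))) ($⁻¹-$ w _))

B : ℕ → Group 0ℓ 0ℓ
B n = record
  { Carrier = SignedPerm n
  ; _≈_ = _≈ᴮ_
  ; _∙_ = _∙ᴮ_
  ; ε = εᴮ
  ; _⁻¹ = _⁻¹ᴮ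
  ; isGroup = record
    { isMonoid = record
      { isSemigroup = record
        { isMagma = record
          { isEquivalence = record
            { refl  = pointwise λ _ → refl
            ; sym   = λ p → pointwise λ x → sym (at p x)
            ; trans = λ p q → pointwise λ x → trans (at p x) (at q x) }
          ; ∙-cong = λ {_} {v} p q → pointwise λ x → trans (at p _) (cong (v $_) (at q x)) }
        ; assoc = λ _ _ _ → pointwise λ _ → refl }
      ; identity = (λ _ → pointwise λ _ → refl) , (λ _ → pointwise λ _ → refl) }
    ; inverse = (λ w → pointwise ($⁻¹-$ w)) , (λ w → pointwise ($-$⁻¹ w))
    ; ⁻¹-cong = λ {v} {w} p → pointwise λ x → trans
        (cong (v $⁻¹_) (trans (sym ($-$⁻¹ w x)) (sym (at p _))))
        ($⁻¹-$ v _) } }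

-- The 2-cycle (a b) on {±1,…,±n}.
swap : ∀ {n} → Signed n → Signed n → Signed n → Signed n
swap a b x with x ≟ₛ a | x ≟ₛ b
... | yes _ | _     = b
... | no _  | yes _ = a
... | no _  | no _  = x

module _ {n : ℕ} where

  swap-left : ∀ (a b : Signed n) → swap a b a ≡ b
  swap-left a b with a ≟ₛ a | a ≟ₛ b
  ... | yes _ | _ = refl
  ... | no ne | _ = ⊥-elim (ne refl)

  swap-right : ∀ (a b : Signed n) → swap a b b ≡ a
  swap-right a b with b ≟ₛ a | b ≟ₛ b
  ... | yes p | _     = p
  ... | no _  | yes _ = refl
  ... | no _  | no ne = ⊥-elim (ne refl)

  swap-fix : ∀ (a b : Signed n) {x} → x ≢ a → x ≢ b → swap a b x ≡ x
  swap-fix a b {x} p q with x ≟ₛ a | x ≟ₛ b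
  ... | yes r | _     = ⊥-elim (p r)
  ... | no _  | yes r = ⊥-elim (q r)
  ... | no _  | no _  = refl

  swap-involutive : ∀ (a b : Signed n) x → swap a b (swap a b x) ≡ x
  swap-involutive a b x = go (x ≟ₛ a) (x ≟ₛ b)
    where
    go : Dec (x ≡ a) → Dec (x ≡ b) → swap a b (swap a b x) ≡ x
    go (yes refl) _ = trans (cong (swap a b) (swap-left a b)) (swap-right a b)
    go _ (yes refl) = trans (cong (swap a b) (swap-right a b)) (swap-left a b)
    go (no p) (no q) = trans (cong (swap a b) (swap-fix a b p q)) (swap-fix a b p q)

  swap-comm : ∀ (a b : Signed n) x → swap a b x ≡ swap b a x
  swap-comm a b x = go (x ≟ₛ a) (x ≟ₛ b)
    where
    go : Dec (x ≡ a) → Dec (x ≡ b) → swap a b x ≡ swap b a x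
    go (yes refl) _ = trans (swap-left a b) (sym (swap-right b a))
    go _ (yes refl) = trans (swap-right a b) (sym (swap-left b a))
    go (no p) (no q) = trans (swap-fix a b p q) (sym (swap-fix b a q p))

  swap-neg : ∀ (a b : Signed n) x → swap a b (neg x) ≡ neg (swap (neg a) (neg b) x)
  swap-neg a b x = go (x ≟ₛ neg a) (x ≟ₛ neg b)
    where
    flip-≢ : ∀ {c} → x ≢ neg c → neg x ≢ c
    flip-≢ p q = p (trans (sym (neg-involutive x)) (cong neg q))
    go : Dec (x ≡ neg a) → Dec (x ≡ neg b) → swap a b (neg x) ≡ neg (swap (neg a) (neg b) x)
    go (yes refl) _ = trans (cong (swap a b) (neg-involutive a)) (trans (swap-left a b)
      (sym (trans (cong neg (swap-left (neg a) (neg b))) (neg-involutive b))))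
    go _ (yes refl) = trans (cong (swap a b) (neg-involutive b)) (trans (swap-right a b)
      (sym (trans (cong neg (swap-right (neg a) (neg b))) (neg-involutive a))))
    go (no p) (no q) = trans (swap-fix a b (flip-≢ p) (flip-≢ q))
      (sym (cong neg (swap-fix (neg a) (neg b) p q)))

  swap-disjoint : ∀ {a b c d : Signed n} → a ≢ c → a ≢ d → b ≢ c → b ≢ d →
    ∀ x → swap a b (swap c d x) ≡ swap c d (swap a b x)
  swap-disjoint {a} {b} {c} {d} ac ad bc bd x = go (x ≟ₛ a) (x ≟ₛ b) (x ≟ₛ c) (x ≟ₛ d)
    where
    go : Dec (x ≡ a) → Dec (x ≡ b) → Dec (x ≡ c) → Dec (x ≡ d) →
      swap a b (swap c d x) ≡ swap c d (swap a b x)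
    go (yes refl) _ _ _ = trans (cong (swap a b) (swap-fix c d ac ad)) (trans (swap-left a b)
      (sym (trans (cong (swap c d) (swap-left a b)) (swap-fix c d bc bd))))
    go _ (yes refl) _ _ = trans (cong (swap a b) (swap-fix c d bc bd)) (trans (swap-right a b)
      (sym (trans (cong (swap c d) (swap-right a b)) (swap-fix c d ac ad))))
    go _ _ (yes refl) _ = trans (cong (swap a b) (swap-left c d))
      (trans (swap-fix a b (ad ∘ sym) (bd ∘ sym))
      (sym (trans (cong (swap c d) (swap-fix a b (ac ∘ sym) (bc ∘ sym))) (swap-left c d))))
    go _ _ _ (yes refl) = trans (cong (swap a b) (swap-right c d))
      (trans (swap-fix a b (ac ∘ sym) (bc ∘ sym))
      (sym (trans (cong (swap c d) (swap-fix a b (ad ∘ sym) (bd ∘ sym))) (swap-right c d))))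
    go (no p) (no q) (no r) (no s) = trans (cong (swap a b) (swap-fix c d r s))
      (trans (swap-fix a b p q)
      (sym (trans (cong (swap c d) (swap-fix a b p q)) (swap-fix c d r s))))

-- The paired 2-cycle ((a , b)) = (a b)(−a −b).
module _ {n} (a b : Signed n) (|a|≢|b| : proj₂ a ≢ proj₂ b) where
  private
    to : Signed n → Signed n
    to = swap a b ∘ swap (neg a) (neg b)

    commute : ∀ x → swap a b (swap (neg a) (neg b) x) ≡ swap (neg a) (neg b) (swap a b x)
    commute = swap-disjoint (neg≢ a ∘ sym) (|a|≢|b| ∘ cong proj₂)
      (|a|≢|b| ∘ sym ∘ cong proj₂) (neg≢ b ∘ sym)

    involutive : ∀ x → to (to x) ≡ x
    involutive x = trans (cong (swap a b) (sym (commute (swap (neg a) (neg b) x))))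
      (trans (swap-involutive a b _) (swap-involutive (neg a) (neg b) x))

  paired : SignedPerm n
  perm paired   = mk↔ₛ′ to to involutive involutive
  odd  paired x = begin
    swap a b (swap (neg a) (neg b) (neg x))
      ≡⟨ cong (swap a b) (swap-neg _ _ x) ⟩
    swap a b (neg (swap (neg (neg a)) (neg (neg b)) x))
      ≡⟨ cong (λ c → swap a b (neg (swap c (neg (neg b)) x))) (neg-involutive a) ⟩
    swap a b (neg (swap a (neg (neg b)) x))
      ≡⟨ cong (λ c → swap a b (neg (swap a c x))) (neg-involutive b) ⟩
    swap a b (neg (swap a b x))
      ≡⟨ swap-neg a b _ ⟩
    neg (swap (neg a) (neg b) (swap a b x))
      ≡⟨ cong neg (sym (commute x)) ⟩
    neg (to x) ∎
    where open ≡-Reasoning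

-- The balanced 1-cycle [ a ] = (a −a).
balanced : ∀ {n} → Signed n → SignedPerm n
perm (balanced a)   =
  mk↔ₛ′ (swap a (neg a)) (swap a (neg a)) (swap-involutive a _) (swap-involutive a _)
odd  (balanced a) x = trans (swap-neg a (neg a) x)
  (trans (cong (λ c → neg (swap (neg a) c x)) (neg-involutive a))
         (cong neg (swap-comm (neg a) a x)))

-- Names for the elements of 𝒯; the sign is the one carried by j, so that
-- (i , j , s) names ((i , s j)).
record Reflection (n : ℕ) : Set where
  constructor reflection
  field
    {i j} : Fin n
    i<j   : i Fin.< j
    s     : Sign

⟦_⟧ᵀ : ∀ {n} → Reflection n → SignedPerm n
⟦ reflection {i} {j} i<j s ⟧ᵀ = paired (Sign.+ , i) (s , j) (Fin.<⇒≢ i<j)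

-- Membership in the subgroup of Bₙ generated by 𝒯.
data InD {n : ℕ} : SignedPerm n → Set where
  gen  : ∀ r → InD ⟦ r ⟧ᵀ
  unit : InD εᴮ
  mul  : ∀ {v w} → InD v → InD w → InD (v ∙ᴮ w)
  inv  : ∀ {w} → InD w → InD (w ⁻¹ᴮ)
  resp : ∀ {v w} → v ≈ᴮ w → InD v → InD w

record DPerm (n : ℕ) : Set where
  no-eta-equality
  constructor _,ᴰ_
  field
    elt : SignedPerm n
    inD : InD elt

open DPerm public

module _ {n : ℕ} where

  infix 4 _≈ᴰ_
  record _≈ᴰ_ (v w : DPerm n) : Set where
    constructor mk≈ᴰ
    field elt≈ : elt v ≈ᴮ elt w
  open _≈ᴰ_ public

  infixr 7 _∙ᴰ_
  _∙ᴰ_ : DPerm n → DPerm n → DPerm n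
  elt (v ∙ᴰ w) = elt v ∙ᴮ elt w
  inD (v ∙ᴰ w) = mul (inD v) (inD w)

  εᴰ : DPerm n
  elt εᴰ = εᴮ
  inD εᴰ = unit

  infix 8 _⁻¹ᴰ
  _⁻¹ᴰ : DPerm n → DPerm n
  elt (w ⁻¹ᴰ) = elt w ⁻¹ᴮ
  inD (w ⁻¹ᴰ) = inv (inD w)

D : ℕ → Group 0ℓ 0ℓ
D n = record
  { Carrier = DPerm n
  ; _≈_ = _≈ᴰ_
  ; _∙_ = _∙ᴰ_
  ; ε   = εᴰ
  ; _⁻¹ = _⁻¹ᴰ
  ; isGroup = record
    { isMonoid = record
      { isSemigroup = record
        { isMagma = record
          { isEquivalence = record
            { refl  = mk≈ᴰ B.refl
            ; sym   = λ p → mk≈ᴰ (B.sym (elt≈ p))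
            ; trans = λ p q → mk≈ᴰ (B.trans (elt≈ p) (elt≈ q)) }
          ; ∙-cong = λ p q → mk≈ᴰ (B.∙-cong (elt≈ p) (elt≈ q)) }
        ; assoc = λ u v w → mk≈ᴰ (B.assoc (elt u) (elt v) (elt w)) }
      ; identity = (λ w → mk≈ᴰ (B.identityˡ (elt w))) , (λ w → mk≈ᴰ (B.identityʳ (elt w))) }
    ; inverse = (λ w → mk≈ᴰ (B.inverseˡ (elt w))) , (λ w → mk≈ᴰ (B.inverseʳ (elt w)))
    ; ⁻¹-cong = λ p → mk≈ᴰ (B.⁻¹-cong (elt≈ p)) } }
  where module B = Group (B n)

𝒯 : ∀ {n} → Reflection n → DPerm n
elt (𝒯 r) = ⟦ r ⟧ᵀ
inD (𝒯 r) = gen r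

module _ {n : ℕ} where
  open Group (D n) hiding (refl; sym; trans)
  private
    module D = Group (D n)
    open GroupProperties (D n)

  IsProductOf : ℕ → Carrier → Set
  IsProductOf k w = ∃ λ (rs : Vec (Reflection n) k) → w ≈ Vec.foldr′ _∙_ ε (Vec.map 𝒯 rs)

  IsAbsoluteLength : Carrier → ℕ → Set
  IsAbsoluteLength w k = IsProductOf k w × (∀ m → IsProductOf m w → k ≤ m)

  infix 4 _≟ᴰ_
  _≟ᴰ_ : ∀ v w → Dec (v ≈ w)
  v ≟ᴰ w = map′
    (λ (p , q) → mk≈ᴰ (pointwise λ { (Sign.+ , i) → p i ; (Sign.- , i) → q i }))
    (λ p → (λ i → at (elt≈ p) (Sign.+ , i)) , (λ i → at (elt≈ p) (Sign.- , i)))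
    (Fin.all? (λ i → elt v $ (Sign.+ , i) ≟ₛ elt w $ (Sign.+ , i)) ×-dec
     Fin.all? (λ i → elt v $ (Sign.- , i) ≟ₛ elt w $ (Sign.- , i)))

  any-reflection? : ∀ {p} {P : Reflection n → Set p} → (∀ r → Dec (P r)) → Dec (∃ P)
  any-reflection? {P = P} P? = map′
    (λ (i , j , i<j , q) → from-sign i<j q)
    (λ (reflection {i} {j} i<j s , p) → i , j , i<j , to-sign i<j s p)
    (Fin.any? λ i → Fin.any? λ j → ordered? i j)
    where
    Q : ∀ {i j} → i Fin.< j → Set _
    Q i<j = P (reflection i<j Sign.+) ⊎ P (reflection i<j Sign.-)
    from-sign : ∀ {i j} (i<j : i Fin.< j) → Q i<j → ∃ P
    from-sign i<j (inj₁ p) = _ , p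
    from-sign i<j (inj₂ p) = _ , p
    to-sign : ∀ {i j} (i<j : i Fin.< j) s → P (reflection i<j s) → Q i<j
    to-sign i<j Sign.+ = inj₁
    to-sign i<j Sign.- = inj₂
    sign? : ∀ {i j} (i<j : i Fin.< j) → Dec (Q i<j)
    sign? i<j with P? (reflection i<j Sign.+) | P? (reflection i<j Sign.-)
    ... | yes p | _     = yes (inj₁ p)
    ... | no _  | yes q = yes (inj₂ q)
    ... | no p  | no q  = no λ { (inj₁ x) → p x ; (inj₂ x) → q x }
    ordered? : ∀ i j → Dec (Σ[ i<j ∈ i Fin.< j ] Q i<j)
    ordered? i j with i Fin.<? j
    ... | no i≮j = no (i≮j ∘ proj₁)
    ... | yes i<j with sign? i<j
    ...   | yes q = yes (i<j , q)
    ...   | no ¬q = no λ (i<j′ , q) → ¬q (subst Q (Fin.<-irrelevant i<j′ i<j) q)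

  product-resp : ∀ {k v w} → v ≈ w → IsProductOf k v → IsProductOf k w
  product-resp v≈w (rs , p) = rs , D.trans (D.sym v≈w) p

  isProductOf? : ∀ k w → Dec (IsProductOf k w)
  isProductOf? zero w = map′ ([] ,_) (λ { ([] , p) → p }) (w ≟ᴰ ε)
  isProductOf? (suc k) w = map′
    (λ (r , rs , p) → r ∷ rs ,
      D.trans (D.sym (\\-leftDividesˡ (𝒯 r) w)) (∙-congˡ p))
    (λ { (r ∷ rs , p) → r , rs ,
      D.trans (∙-congˡ {𝒯 r ⁻¹} p) (\\-leftDividesʳ (𝒯 r) _) })
    (any-reflection? λ r → isProductOf? k (𝒯 r ⁻¹ ∙ w))

  product-∙ : ∀ {k m v w} → IsProductOf k v → IsProductOf m w → IsProductOf (k + m) (v ∙ w)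
  product-∙ {v = v} {w} ([] , p) (ss , q) =
    ss , D.trans (∙-cong {v} {ε} {w} {w} p D.refl) (D.trans (identityˡ w) q)
  product-∙ {v = v} {w} (r ∷ rs , p) q =
    let (ss , h) = product-∙ (rs , D.refl) q in
    r ∷ ss , D.trans (D.trans (∙-congʳ p) (assoc (𝒯 r) _ w)) (∙-congˡ h)

  𝒯⁻¹ : ∀ r → 𝒯 r ⁻¹ ≈ 𝒯 r
  𝒯⁻¹ r = mk≈ᴰ (pointwise λ _ → refl)

  product-⁻¹ : ∀ {k w} → IsProductOf k w → ∃ λ m → IsProductOf m (w ⁻¹)
  product-⁻¹ {w = w} ([] , p) = 0 , [] , D.trans (⁻¹-cong {w} {ε} p) ε⁻¹≈ε
  product-⁻¹ (r ∷ rs , p) =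
    let (m , h) = product-⁻¹ (rs , D.refl)
    in m + 1 , product-resp
         (D.sym (D.trans (⁻¹-cong p) (D.trans (⁻¹-anti-homo-∙ (𝒯 r) _) (∙-congˡ (𝒯⁻¹ r)))))
         (product-∙ h (r ∷ [] , D.sym (identityʳ (𝒯 r))))

  generated⇒product : ∀ {w : SignedPerm n} (g : InD w) → ∃ λ m → IsProductOf m (w ,ᴰ g)
  generated⇒product (gen r)   = 1 , r ∷ [] , mk≈ᴰ (pointwise λ _ → refl)
  generated⇒product unit      = 0 , [] , mk≈ᴰ (pointwise λ _ → refl)
  generated⇒product (mul g h) =
    let (k , p) = generated⇒product g ; (m , q) = generated⇒product h
    in k + m , product-resp (mk≈ᴰ (pointwise λ _ → refl)) (product-∙ p q)
  generated⇒product (inv g)   =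
    let (m , p) = product-⁻¹ (proj₂ (generated⇒product g))
    in m , product-resp (mk≈ᴰ (pointwise λ _ → refl)) p
  generated⇒product (resp e g) =
    let (m , p) = generated⇒product g in m , product-resp (mk≈ᴰ e) p

  least : ∀ {p} {P : ℕ → Set p} → (∀ k → Dec (P k)) → ∀ m → P m →
    ∃ λ k → P k × (∀ m → P m → k ≤ m)
  least P? zero    p = zero , p , λ _ _ → z≤n
  least {P = P} P? (suc m) p with P? zero
  ... | yes p₀ = zero , p₀ , λ _ _ → z≤n
  ... | no ¬p₀ =
    let (k , q , min) = least (P? ∘ suc) m p
    in suc k , q , λ { zero p₀ → ⊥-elim (¬p₀ p₀) ; (suc j) pⱼ → s≤s (min j pⱼ) }

  -- Determined up to equality by its type; opaque so that the search for the
  -- least k is not unfolded during type checking.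
  opaque
    absoluteLength : ∀ w → ∃ (IsAbsoluteLength w)
    absoluteLength w =
      let (m , p) = generated⇒product (inD w)
      in least (λ k → isProductOf? k w) m (product-resp (mk≈ᴰ (pointwise λ _ → refl)) p)

  ℓ𝒯 : Carrier → ℕ
  ℓ𝒯 w = proj₁ (absoluteLength w)

  infix 4 _≼_
  _≼_ : Rel Carrier 0ℓ
  u ≼ v = ℓ𝒯 u + ℓ𝒯 (u ⁻¹ ∙ v) ≡ ℓ𝒯 v

  ℓ-product : ∀ w → IsProductOf (ℓ𝒯 w) w
  ℓ-product w = proj₁ (proj₂ (absoluteLength w))

  ℓ-least : ∀ w {m} → IsProductOf m w → ℓ𝒯 w ≤ m
  ℓ-least w = proj₂ (proj₂ (absoluteLength w)) _

  ℓ-cong : ∀ {v w} → v ≈ w → ℓ𝒯 v ≡ ℓ𝒯 w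
  ℓ-cong {v} {w} v≈w = ≤-antisym
    (ℓ-least v (product-resp (D.sym v≈w) (ℓ-product w)))
    (ℓ-least w (product-resp v≈w (ℓ-product v)))

  ℓ-∙ : ∀ v w → ℓ𝒯 (v ∙ w) ≤ ℓ𝒯 v + ℓ𝒯 w
  ℓ-∙ v w = ℓ-least (v ∙ w) (product-∙ (ℓ-product v) (ℓ-product w))

  ℓ≡0⇒≈ε : ∀ w → ℓ𝒯 w ≡ 0 → w ≈ ε
  ℓ≡0⇒≈ε w p with subst (λ k → IsProductOf k w) p (ℓ-product w)
  ... | [] , q = q

  ≼-reflexive : ∀ {u v} → u ≈ v → u ≼ v
  ≼-reflexive {u} {v} u≈v = begin
    ℓ𝒯 u + ℓ𝒯 (u ⁻¹ ∙ v) ≡⟨ cong (ℓ𝒯 u +_) (≤-antisym (ℓ-least _ ([] , u⁻¹v≈ε)) z≤n) ⟩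
    ℓ𝒯 u + 0             ≡⟨ +-identityʳ _ ⟩
    ℓ𝒯 u                 ≡⟨ ℓ-cong u≈v ⟩
    ℓ𝒯 v                 ∎
    where
    open ≡-Reasoning
    u⁻¹v≈ε : u ⁻¹ ∙ v ≈ ε
    u⁻¹v≈ε = D.trans (∙-congˡ {u ⁻¹} (D.sym u≈v)) (inverseˡ u)

  ≼-trans : ∀ {u v w} → u ≼ v → v ≼ w → u ≼ w
  ≼-trans {u} {v} {w} p q = ≤-antisym
    (≤-trans (+-monoʳ-≤ (ℓ𝒯 u) step) (≤-reflexive
      (trans (sym (+-assoc (ℓ𝒯 u) _ _)) (trans (cong (_+ ℓ𝒯 (v ⁻¹ ∙ w)) p) q))))
    (subst (_≤ ℓ𝒯 u + ℓ𝒯 (u ⁻¹ ∙ w)) (ℓ-cong (\\-leftDividesˡ u w)) (ℓ-∙ u (u ⁻¹ ∙ w)))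
    where
    telescope : (u ⁻¹ ∙ v) ∙ (v ⁻¹ ∙ w) ≈ u ⁻¹ ∙ w
    telescope = D.trans (assoc (u ⁻¹) v (v ⁻¹ ∙ w)) (∙-congˡ {u ⁻¹} (\\-leftDividesˡ v w))
    step : ℓ𝒯 (u ⁻¹ ∙ w) ≤ ℓ𝒯 (u ⁻¹ ∙ v) + ℓ𝒯 (v ⁻¹ ∙ w)
    step = subst (_≤ ℓ𝒯 (u ⁻¹ ∙ v) + ℓ𝒯 (v ⁻¹ ∙ w)) (ℓ-cong telescope) (ℓ-∙ (u ⁻¹ ∙ v) (v ⁻¹ ∙ w))

  ≼-antisym : ∀ {u v} → u ≼ v → v ≼ u → u ≈ v
  ≼-antisym {u} {v} p q = D.sym (D.trans (D.sym (\\-leftDividesˡ u v))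
    (D.trans (∙-congˡ {u} (ℓ≡0⇒≈ε _ zero-gap)) (identityʳ u)))
    where
    sum≡0 : ℓ𝒯 (u ⁻¹ ∙ v) + ℓ𝒯 (v ⁻¹ ∙ u) ≡ 0
    sum≡0 = +-cancelˡ-≡ (ℓ𝒯 u) _ _ (trans (sym (+-assoc (ℓ𝒯 u) _ _))
      (trans (cong (_+ ℓ𝒯 (v ⁻¹ ∙ u)) p) (trans q (sym (+-identityʳ _)))))
    zero-gap : ℓ𝒯 (u ⁻¹ ∙ v) ≡ 0
    zero-gap = m+n≡0⇒m≡0 _ sum≡0

  absPoset : Poset 0ℓ 0ℓ 0ℓ
  absPoset = record
    { _≤_ = _≼_
    ; isPartialOrder = record
      { isPreorder = record
        { isEquivalence = isEquivalence
        ; reflexive = λ {u} {v} → ≼-reflexive {u} {v}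
        ; trans     = λ {u} {v} {w} → ≼-trans {u} {v} {w} }
      ; antisym = λ {u} {v} → ≼-antisym {u} {v} } }

Abs : ℕ → Poset 0ℓ 0ℓ 0ℓ
Abs n = absPoset {n}

e₄ : Group.Carrier (D 4)
e₄ = Group.ε (D 4)

-- [1][2][3][4], which lies in D₄ since it equals
-- ((1,2)) ((1,−2)) ((3,4)) ((3,−4)).
u₄ : Group.Carrier (D 4)
u₄ = u ,ᴰ resp {v = product} (pointwise same)
  (mul (gen (t₁₂ Sign.+)) (mul (gen (t₁₂ Sign.-)) (mul (gen (t₃₄ Sign.+)) (gen (t₃₄ Sign.-)))))
  where
  [_] : Fin 4 → SignedPerm 4
  [ i ] = balanced (Sign.+ , i)
  u : SignedPerm 4
  u = [ Fin.# 0 ] ∙ᴮ [ Fin.# 1 ] ∙ᴮ [ Fin.# 2 ] ∙ᴮ [ Fin.# 3 ]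
  t₁₂ t₃₄ : Sign → Reflection 4
  t₁₂ = reflection {i = Fin.# 0} {Fin.# 1} (s≤s z≤n)
  t₃₄ = reflection {i = Fin.# 2} {Fin.# 3} (s≤s (s≤s (s≤s z≤n)))
  product : SignedPerm 4
  product = ⟦ t₁₂ Sign.+ ⟧ᵀ ∙ᴮ ⟦ t₁₂ Sign.- ⟧ᵀ ∙ᴮ ⟦ t₃₄ Sign.+ ⟧ᵀ ∙ᴮ ⟦ t₃₄ Sign.- ⟧ᵀ
  same : ∀ x → product $ x ≡ u $ x
  same (Sign.+ , i) = from-yes (Fin.all? λ j → product $ (Sign.+ , j) ≟ₛ u $ (Sign.+ , j)) i
  same (Sign.- , i) = from-yes (Fin.all? λ j → product $ (Sign.- , j) ≟ₛ u $ (Sign.- , j)) i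

module _ (P : Poset a ℓ₁ ℓ₂) where
  open Poset P
    using (Carrier; _≈_) renaming (_≤_ to _⊑_)
  open PosetProperties P using () renaming (_<_ to _⊏_)

  closedInterval : Carrier → Carrier → Poset (a ⊔ ℓ₂) ℓ₁ ℓ₂
  closedInterval x y = On.poset P (proj₁ {B = λ z → x ⊑ z × z ⊑ y})

  openInterval : Carrier → Carrier → Poset (a ⊔ ℓ₁ ⊔ ℓ₂) ℓ₁ ℓ₂
  openInterval x y = On.poset P (proj₁ {B = λ z → x ⊏ z × z ⊏ y})

  Covers : Rel Carrier (a ⊔ ℓ₁ ⊔ ℓ₂)
  Covers x y = x ⊏ y × ¬ (∃ λ z → x ⊏ z × z ⊏ y)

  -- Joined by a path in the Hasse diagram.  Elements are taken up to _≈_, so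
  -- steps between equal elements are allowed as well as edges.
  Joined : Rel Carrier (a ⊔ ℓ₁ ⊔ ℓ₂)
  Joined = EqClosure (λ x y → x ≈ y ⊎ Covers x y)

  HasseDisconnected : Set (a ⊔ ℓ₁ ⊔ ℓ₂)
  HasseDisconnected = ∃₂ λ x y → ¬ Joined x y

-- A finite vertex set is given by any list enumerating it, in any order and
-- possibly with repetitions.
record SimplicialComplex (V : Setoid a ℓ) f : Set (a ⊔ ℓ ⊔ lsuc f) where
  open Setoid V using (Carrier)
  open ListSubset V using (_⊆_)
  field
    Face   : List Carrier → Set f
    closed : ∀ {F G} → F ⊆ G → Face G → Face F

orderComplex : (P : Poset a ℓ₁ ℓ₂) → SimplicialComplex (Poset.Eq.setoid P) (a ⊔ ℓ₁ ⊔ ℓ₂)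
orderComplex P = record
  { Face   = λ F → ∀ {x y} → x ∈ F → y ∈ F → x ⊑ y ⊎ y ⊑ x
  ; closed = λ F⊆G chain x∈F y∈F → chain (F⊆G x∈F) (F⊆G y∈F) }
  where
  open Poset P using () renaming (_≤_ to _⊑_)
  open Membership (Poset.Eq.setoid P) using (_∈_)

module _ {V : Setoid a ℓ} (K : SimplicialComplex V f) where
  open Setoid V using (Carrier; _≈_)
  open SimplicialComplex K
  open ListDisjoint V using (Disjoint)
  open Membership V using (_∈_)

  link : List Carrier → SimplicialComplex V (a ⊔ ℓ ⊔ f)
  link F = record
    { Face   = λ G → Disjoint F G × Face (F ++ G)
    ; closed = λ {G} {H} G⊆H (disjoint , face) →
        (λ (v∈F , v∈G) → disjoint (v∈F , G⊆H v∈G)) ,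
        closed (λ v∈F++G → monotone G⊆H (Membershipₚ.∈-++⁻ V F v∈F++G)) face }
    where
    monotone : ∀ {G H v} → (∀ {x} → x ∈ G → x ∈ H) → v ∈ F ⊎ v ∈ G → v ∈ F ++ H
    monotone G⊆H (inj₁ v∈F) = Membershipₚ.∈-++⁺ˡ V v∈F
    monotone G⊆H (inj₂ v∈G) = Membershipₚ.∈-++⁺ʳ V F (G⊆H v∈G)

  -- A face with exactly m elements (so of dimension m − 1), together with an
  -- ordering of its vertices.
  record Simplex (m : ℕ) : Set (a ⊔ ℓ ⊔ f) where
    field
      vertex   : Fin m → Carrier
      distinct : Injective _≡_ _≈_ vertex
      isFace   : Face (tabulate vertex)

  open Simplex

  delete : ∀ {m} → Fin (suc m) → Simplex (suc m) → Simplex m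
  delete i σ = record
    { vertex   = vertex σ ∘ punchIn i
    ; distinct = Fin.punchIn-injective i _ _ ∘ distinct σ
    ; isFace   = closed sub (isFace σ) }
    where
    sub : ∀ {v} → v ∈ tabulate (vertex σ ∘ punchIn i) → v ∈ tabulate (vertex σ)
    sub v∈ =
      let (j , v≈) = Membershipₚ.∈-tabulate⁻ V v∈
      in Membershipₚ.∈-resp-≈ V (Setoid.sym V v≈) (Membershipₚ.∈-tabulate⁺ V {f = vertex σ} (punchIn i j))

  -- dim K = d − 1
  HasDimensionPred : ℕ → Set (a ⊔ ℓ ⊔ f)
  HasDimensionPred d = Simplex d × (∀ m → Simplex m → m ≤ d)

module Homology {c r} (R : CommutativeRing c r)
                {V : Setoid a ℓ} (K : SimplicialComplex V f) where
  private module R = CommutativeRing R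
  open RawSemiringDefs (Semiring.rawSemiring R.semiring) using (_^_)
  open Simplex

  infixl 6 _⊕_
  infixr 7 _·_
  infix  4 _~_

  -- Oriented simplicial (m−1)-chains: the free R-module on the ordered
  -- (m−1)-simplices, modulo σ∘π = sign(π) σ.  Chain m is the type of its
  -- formal expressions and _~_ the equality of the module, generated by the
  -- module axioms and the orientation relation for transpositions π.
  data Chain (m : ℕ) : Set (a ⊔ ℓ ⊔ f ⊔ c) where
    𝟘   : Chain m
    _⊕_ : Chain m → Chain m → Chain m
    _·_ : R.Carrier → Chain m → Chain m
    ⟨_⟩ : Simplex K m → Chain m

  data _~_ {m : ℕ} : Chain m → Chain m → Set (a ⊔ ℓ ⊔ f ⊔ c ⊔ r) where
    ~-refl      : ∀ {x} → x ~ x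
    ~-sym       : ∀ {x y} → x ~ y → y ~ x
    ~-trans     : ∀ {x y z} → x ~ y → y ~ z → x ~ z
    ⊕-cong      : ∀ {x x′ y y′} → x ~ x′ → y ~ y′ → x ⊕ y ~ x′ ⊕ y′
    ·-cong      : ∀ {p q x y} → p R.≈ q → x ~ y → p · x ~ q · y
    ⊕-assoc     : ∀ x y z → (x ⊕ y) ⊕ z ~ x ⊕ (y ⊕ z)
    ⊕-comm      : ∀ x y → x ⊕ y ~ y ⊕ x
    ⊕-identity  : ∀ x → 𝟘 ⊕ x ~ x
    ·-distrib-⊕ : ∀ p x y → p · (x ⊕ y) ~ p · x ⊕ p · y
    ·-distrib-+ : ∀ p q x → (p R.+ q) · x ~ p · x ⊕ q · x
    ·-assoc     : ∀ p q x → (p R.* q) · x ~ p · (q · x)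
    ·-identity  : ∀ x → R.1# · x ~ x
    ·-zero      : ∀ x → R.0# · x ~ 𝟘
    vertices    : ∀ {σ τ} → (∀ l → Setoid._≈_ V (vertex σ l) (vertex τ l)) → ⟨ σ ⟩ ~ ⟨ τ ⟩
    orientation : ∀ {σ τ i j} → i ≢ j →
      (∀ l → Setoid._≈_ V (vertex τ l) (vertex σ (transpose i j l))) →
      ⟨ τ ⟩ ~ (R.- R.1#) · ⟨ σ ⟩

  ∂ : ∀ {m} → Chain (suc m) → Chain m
  ∂ 𝟘       = 𝟘
  ∂ (x ⊕ y) = ∂ x ⊕ ∂ y
  ∂ (p · x) = p · ∂ x
  ∂ ⟨ σ ⟩   = foldr _⊕_ 𝟘 (λ i → ((R.- R.1#) ^ toℕ i) · ⟨ delete K i σ ⟩)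

  -- The chain group in degree −1 is spanned by the empty face, and the one
  -- in degree −2 is zero.
  IsCycle : ∀ {m} → Chain m → Set (a ⊔ ℓ ⊔ f ⊔ c ⊔ r)
  IsCycle {zero}  z = ⊤
  IsCycle {suc m} z = ∂ z ~ 𝟘

  -- H̃ in degree m − 1 is zero.
  ReducedHomologyVanishesPred : ℕ → Set (a ⊔ ℓ ⊔ f ⊔ c ⊔ r)
  ReducedHomologyVanishesPred m = (z : Chain m) → IsCycle z → ∃ λ (b : Chain (suc m)) → ∂ b ~ z

module _ {c r₁ r₂} (k : HeytingField c r₁ r₂) where
  private
    kRing : CommutativeRing c r₁
    kRing = HeytingCommutativeRing.commutativeRing (HeytingField.heytingCommutativeRing k)

  -- With d = dim + 1 and m = i + 1, the range m < d is exactly −1 ≤ i < dim;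
  -- for i < −1 reduced homology is zero.
  CohenMacaulayComplex : {V : Setoid a ℓ} → SimplicialComplex V f → Set (a ⊔ ℓ ⊔ f ⊔ c ⊔ r₁)
  CohenMacaulayComplex K =
    ∀ F → SimplicialComplex.Face K F →
    ∀ d → HasDimensionPred (link K F) d →
    ∀ m → m < d → Homology.ReducedHomologyVanishesPred kRing (link K F) m

  CohenMacaulay : Poset a ℓ₁ ℓ₂ → Set (a ⊔ ℓ₁ ⊔ ℓ₂ ⊔ c ⊔ r₁)
  CohenMacaulay P = CohenMacaulayComplex (orderComplex P)

{-# OPTIONS --safe #-}

-- Since u = [1][2][3][4] has absolute length 4, a chain in (e, u) is given by
-- prefixes of a factorisation u = r₁r₂r₃r₄ into reflections.  The rᵢ all lie in
-- one of the three classes {((i,±j)), ((k,±l))} of mutually orthogonal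
-- reflections of D₄, so comparable elements of (e, u) lie in the subgroup
-- generated by the same class.  Whether that is the class of ((1,2)) is
-- therefore constant on connected components, yet differs at ((1,2)) and
-- ((1,3)).
--
-- For n ≥ 4 the rᵢ a priori lie in Dₙ.  For f ∈ (ℤ/3)ⁿ, r₁⋯rₖ f − f is a
-- combination of the k roots whose coefficients depend linearly on f; applied to
-- the f supported on the first four coordinates, where u f − f = f, counting
-- gives k ≥ 4, and if k = 4 every combination of the roots is so supported.
--
-- The order complex of (e, u) is the link of a face of Δ(Abs(Dₙ)) and has
-- dimension 2, but its H̃₀ is nonzero.

module Submission where

open import Defs
open import Algebra.Apartness.Bundles using (HeytingField; HeytingCommutativeRing)
open import Algebra.Bundles using (Group; CommutativeRing)
import Algebra.Properties.Group as GroupProperties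
import Algebra.Properties.Ring as RingProperties
open import Data.Bool using (Bool; true; false; if_then_else_)
import Data.Bool.Properties as Bool
open import Data.Fin
  using (Fin; zero; suc; toℕ; fromℕ<; splitAt; join; combine; finToFun; funToFin; _↑ˡ_; _↑ʳ_)
import Data.Fin as Fin
open import Data.Fin.Patterns using (0F; 1F; 2F; 3F)
import Data.Fin.Properties as Fin
open import Data.List using (List; []; _∷_; tabulate)
import Data.List.Membership.Setoid as Membership
import Data.List.Membership.Setoid.Properties as Membershipₚ
open import Data.List.Relation.Unary.Any using (here; there)
open import Data.Nat
  using (ℕ; zero; suc; pred; _+_; _^_; _≤_; _<_; z≤n; s≤s; >-nonZero)
import Data.Nat.Properties as ℕ
open import Data.Product using (∃; ∃₂; _×_; _,_; proj₁; proj₂)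
open import Data.Sign using (Sign; opposite)
open import Data.Sum using (_⊎_; inj₁; inj₂; [_,_]′)
import Data.Sum as Sum
open import Data.Vec using (Vec; []; _∷_; _++_; lookup)
import Data.Vec as Vec
open import Function using (_∘_; Injective; const)
open import Level using (Level; _⊔_)
open import Relation.Binary.Bundles using (Setoid; Poset)
import Relation.Binary.Construct.Closure.Equivalence as EqClosure
import Relation.Binary.Properties.Poset as PosetProperties
open import Relation.Binary.PropositionalEquality
  using (_≡_; _≢_; _≗_; refl; sym; trans; cong; cong₂; subst; subst₂; isEquivalence;
         module ≡-Reasoning)
import Relation.Binary.Reasoning.Setoid as SetoidReasoning
open import Relation.Nullary using (¬_; Dec; yes; no; does; contradiction)
open import Relation.Nullary.Decidable using (map′; from-yes; _×-dec_; _⊎-dec_; _→-dec_; ¬?)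

open Simplex

private variable
  a ℓ ℓ₁ ℓ₂ ℓ₃ c r : Level

-- If no such `m` existed, `reach` would carry `Q` upwards past the bound. The double negation
-- avoids deciding `Q` and is enough wherever the goal is a contradiction.
¬¬-maximum : {Q : ℕ → Set a} (M : ℕ) → (∀ m → Q m → m ≤ M) → Q 0 →
             ¬ ¬ (∃ λ m → Q m × ¬ Q (suc m))
¬¬-maximum {Q = Q} M bound q₀ none = reach (suc M) λ q → ℕ.1+n≰n (bound _ q)
  where
  reach : ∀ m → ¬ ¬ Q m
  reach zero    ¬q = ¬q q₀
  reach (suc m) ¬q = reach m λ q → none (m , q , ¬q)

-- Reduced homology in degree 0

module _ (R : CommutativeRing c r) {V : Setoid a ℓ} (K : SimplicialComplex V ℓ₃) where
  open CommutativeRing R hiding (refl; sym; trans; zero) renaming (_+_ to _+ᴿ_)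
  open SetoidReasoning setoid
  open RingProperties ring using (-1*x≈-x)
  private
    module R = CommutativeRing R
    module V = Setoid V
  open Homology R K

  -- The colouring `q` gives the linear functional `φ` on 0-chains that sends a vertex to 1 or 0. It
  -- kills boundaries, as the ends of an edge share a colour, yet takes the value 1 on the cycle σ -
  -- τ.
  two-components⇒trivial :
    (q : V.Carrier → Bool) →
    (∀ (σ τ : Simplex K 1) → vertex σ zero V.≈ vertex τ zero →
      q (vertex σ zero) ≡ q (vertex τ zero)) →
    (∀ (σ : Simplex K 2) → q (vertex σ zero) ≡ q (vertex σ (suc zero))) →
    (σ τ : Simplex K 1) → q (vertex σ zero) ≡ true → q (vertex τ zero) ≡ false →
    ReducedHomologyVanishesPred 1 → 1# ≈ 0#
  two-components⇒trivial q q-cong q-edge σ τ qσ qτ vanish =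
    let (b , ∂b~σ-τ) = vanish (⟨ σ ⟩ ⊕ (- 1#) · ⟨ τ ⟩) cycle in begin
    1#                     ≈⟨ +-identityʳ 1# ⟨
    1# +ᴿ 0#                ≈⟨ +-congˡ (zeroʳ (- 1#)) ⟨
    1# +ᴿ - 1# * 0#         ≡⟨ cong (λ p → mark p +ᴿ - 1# * 0#) qσ ⟨
    weight σ +ᴿ - 1# * 0#   ≡⟨ cong (λ p → weight σ +ᴿ - 1# * mark p) qτ ⟨
    weight σ +ᴿ - 1# * weight τ ≈⟨ φ-cong ∂b~σ-τ ⟨
    φ (∂ b)                ≈⟨ φ-∂ b ⟩
    0#                     ∎
    where
    mark : Bool → Carrier
    mark p = if p then 1# else 0#

    weight : Simplex K 1 → Carrier
    weight ρ = mark (q (vertex ρ zero))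

    φ : Chain 1 → Carrier
    φ 𝟘       = 0#
    φ (x ⊕ y) = φ x +ᴿ φ y
    φ (p · x) = p * φ x
    φ ⟨ ρ ⟩   = weight ρ

    φ-cong : ∀ {x y} → x ~ y → φ x ≈ φ y
    φ-cong ~-refl              = R.refl
    φ-cong (~-sym p)           = R.sym (φ-cong p)
    φ-cong (~-trans p q)       = R.trans (φ-cong p) (φ-cong q)
    φ-cong (⊕-cong p q)        = +-cong (φ-cong p) (φ-cong q)
    φ-cong (·-cong p q)        = *-cong p (φ-cong q)
    φ-cong (⊕-assoc _ _ _)     = +-assoc _ _ _
    φ-cong (⊕-comm _ _)        = +-comm _ _
    φ-cong (⊕-identity _)      = +-identityˡ _
    φ-cong (·-distrib-⊕ _ _ _) = distribˡ _ _ _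
    φ-cong (·-distrib-+ _ _ _) = distribʳ _ _ _
    φ-cong (·-assoc _ _ _)     = *-assoc _ _ _
    φ-cong (·-identity _)      = *-identityˡ _
    φ-cong (·-zero _)          = zeroˡ _
    φ-cong (vertices {ρ} {π} p) = R.reflexive (cong mark (q-cong ρ π (p zero)))
    -- A 0-simplex has a single vertex, so there is no transposition to reverse its orientation.
    φ-cong (orientation {i = zero} {zero} i≢j _) = contradiction refl i≢j

    φ-∂ : ∀ x → φ (∂ x) ≈ 0#
    φ-∂ 𝟘       = R.refl
    φ-∂ (x ⊕ y) = R.trans (+-cong (φ-∂ x) (φ-∂ y)) (+-identityˡ 0#)
    φ-∂ (p · x) = R.trans (*-congˡ (φ-∂ x)) (zeroʳ p)
    φ-∂ ⟨ ρ ⟩   = begin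
      1# * mark (q (vertex ρ (suc zero))) +ᴿ (- 1# * 1# * w +ᴿ 0#)
        ≡⟨ cong (λ p → 1# * mark p +ᴿ (- 1# * 1# * w +ᴿ 0#)) (q-edge ρ) ⟨
      1# * w +ᴿ (- 1# * 1# * w +ᴿ 0#) ≈⟨ +-cong (*-identityˡ w) (+-identityʳ _) ⟩
      w +ᴿ - 1# * 1# * w             ≈⟨ +-congˡ (*-congʳ (*-identityʳ (- 1#))) ⟩
      w +ᴿ - 1# * w                  ≈⟨ +-congˡ (-1*x≈-x w) ⟩
      w +ᴿ - w                       ≈⟨ -‿inverseʳ w ⟩
      0#                            ∎
      where
      w : Carrier
      w = mark (q (vertex ρ zero))

    cycle : ∂ (⟨ σ ⟩ ⊕ (- 1#) · ⟨ τ ⟩) ~ 𝟘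
    cycle = ~-trans
      (⊕-cong (~-trans ∂σ~∅ (~-sym (·-identity ⟨ delete K zero σ ⟩))) (·-cong R.refl ∂τ~∅))
      (~-trans (~-sym (·-distrib-+ 1# (- 1#) _))
      (~-trans (·-cong (-‿inverseʳ 1#) ~-refl) (·-zero _)))
      where
      ∂σ~∅ : ∂ ⟨ σ ⟩ ~ ⟨ delete K zero σ ⟩
      ∂σ~∅ = ~-trans (⊕-comm _ _) (~-trans (⊕-identity _) (·-identity _))
      -- The empty faces of `σ` and `τ` arise from different simplices; `vertices` identifies them
      -- in the chain module.
      ∂τ~∅ : ∂ ⟨ τ ⟩ ~ ⟨ delete K zero σ ⟩
      ∂τ~∅ = ~-trans (~-trans (⊕-comm _ _) (~-trans (⊕-identity _) (·-identity _)))
        (vertices λ ())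

-- If 1 = 0, then 0 - 0 is invertible with inverse 0, which makes 0 apart from itself.
field-nontrivial : (k : HeytingField c ℓ₁ ℓ₂) (let open HeytingField k) → ¬ (1# ≈ 0#)
field-nontrivial k 1≈0 =
  #-irrefl {0#} K.refl (invertible⇒# (0# , 0*z≈1 , K.trans (*-comm _ _) 0*z≈1))
  where
  open HeytingField k
  module K = CommutativeRing (HeytingCommutativeRing.commutativeRing heytingCommutativeRing)
  0*z≈1 : ∀ {z} → 0# * z ≈ 1#
  0*z≈1 {z} = K.trans (K.zeroˡ z) (K.sym 1≈0)

-- Order complexes and links of intervals

module _ (P : Poset a ℓ₁ ℓ₂) where
  open Poset P using (Carrier; _≈_; module Eq) renaming (_≤_ to _⊑_)
  private module P = Poset P
  open PosetProperties P using () renaming (_<_ to _⊏_)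
  open Membership Eq.setoid using (_∈_)

  Comparable : Carrier → Carrier → Set ℓ₂
  Comparable z w = z ⊑ w ⊎ w ⊑ z

  Between : Carrier → Carrier → Carrier → Set (ℓ₁ ⊔ ℓ₂)
  Between x y z = x ⊏ z × z ⊏ y

  comparable-resp : ∀ {z z′ w w′} → z′ ≈ z → w′ ≈ w → Comparable z w → Comparable z′ w′
  comparable-resp p q = Sum.map
    (λ z⊑w → P.trans (P.reflexive p) (P.trans z⊑w (P.reflexive (Eq.sym q))))
    (λ w⊑z → P.trans (P.reflexive q) (P.trans w⊑z (P.reflexive (Eq.sym p))))

  simplex : ∀ {m} (v : Fin m → Carrier) → Injective _≡_ _≈_ v →
            (∀ i j → Comparable (v i) (v j)) → Simplex (orderComplex P) m
  simplex v v-injective comparable = record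
    { vertex   = v
    ; distinct = v-injective
    ; isFace   = λ z∈ w∈ →
        let (i , z≈vᵢ) = Membershipₚ.∈-tabulate⁻ Eq.setoid z∈
            (j , w≈vⱼ) = Membershipₚ.∈-tabulate⁻ Eq.setoid w∈
        in comparable-resp z≈vᵢ w≈vⱼ (comparable i j) }

  vertices-comparable : ∀ {m} (σ : Simplex (orderComplex P) m) i j →
                        Comparable (vertex σ i) (vertex σ j)
  vertices-comparable σ i j = isFace σ (∈-vertices i) (∈-vertices j)
    where
    ∈-vertices : ∀ i → vertex σ i ∈ tabulate (vertex σ)
    ∈-vertices = Membershipₚ.∈-tabulate⁺ Eq.setoid {f = vertex σ}

  cons : ∀ {m} z (σ : Simplex (orderComplex P) m) → (∀ i → ¬ z ≈ vertex σ i) →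
         (∀ i → Comparable z (vertex σ i)) → Simplex (orderComplex P) (suc m)
  cons {m} z σ z≉ z~ = simplex v v-injective comparable
    where
    v : Fin (suc m) → Carrier
    v zero    = z
    v (suc i) = vertex σ i
    v-injective : Injective _≡_ _≈_ v
    v-injective {zero}  {zero}  _ = refl
    v-injective {zero}  {suc j} p = contradiction p (z≉ j)
    v-injective {suc i} {zero}  p = contradiction (Eq.sym p) (z≉ i)
    v-injective {suc i} {suc j} p = cong suc (distinct σ p)
    comparable : ∀ i j → Comparable (v i) (v j)
    comparable zero    zero    = inj₁ P.refl
    comparable zero    (suc j) = z~ j
    comparable (suc i) zero    = Sum.swap (z~ i)
    comparable (suc i) (suc j) = vertices-comparable σ i j

  -- Let F consist of x, y and a chain of maximal size above y.  The link of F
  -- is the order complex of the open interval (x, y).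
  split-interval⇒¬CohenMacaulay : ∀ {x y} →
    (∀ z → x ⊑ z) →
    (M : ℕ) → (∀ m → Simplex (orderComplex P) m → m ≤ M) →
    (d : ℕ) → 2 ≤ d →
    (ρ : Simplex (orderComplex P) d) → (∀ i → Between x y (vertex ρ i)) →
    (∀ m (σ : Simplex (orderComplex P) m) → (∀ i → Between x y (vertex σ i)) → m ≤ d) →
    (q : Carrier → Bool) →
    (∀ {z w} → Between x y z → Between x y w → z ⊑ w → q z ≡ q w) →
    (z w : Carrier) → Between x y z → Between x y w → q z ≡ true → q w ≡ false →
    (k : HeytingField c r ℓ₃) → ¬ CohenMacaulay k P
  split-interval⇒¬CohenMacaulay {x = x} {y} minimum M bounded d 2≤d ρ ρ-between d-max
    q q-mono z w z-between w-between qz qw k CM =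
    ¬¬-maximum {Q = ChainAbove} M (λ m (σ , _) → bounded m σ) empty contradict
    where
    open HeytingField k using (heytingCommutativeRing)

    ChainAbove : ℕ → Set _
    ChainAbove m = ∃ λ (σ : Simplex (orderComplex P) m) → ∀ i → y ⊑ vertex σ i

    empty : ChainAbove 0
    empty = simplex (λ ()) (λ {i} → contradiction i λ ()) (λ ()) , λ ()

    contradict : ¬ ∃ λ m → ChainAbove m × ¬ ChainAbove (suc m)
    contradict (m , (τ , y⊑τ) , τ-maximal) = field-nontrivial k
      (two-components⇒trivial (HeytingCommutativeRing.commutativeRing heytingCommutativeRing)
        L q
        (λ σ π p → q-mono (link-between σ zero) (link-between π zero) (P.reflexive p))
        q-edge (point z z-between) (point w w-between) qz qw
        -- The index 1 stands for H̃₀. The link has dimension d - 1, so 2 ≤ d puts degree 0 below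
        -- the top.
        (CM F F-face d
          (to-link ρ ρ-between , λ m σ → d-max m (from-link σ) (link-between σ))
          1 2≤d))
      where
      F : List Carrier
      F = x ∷ y ∷ tabulate (vertex τ)

      L = link (orderComplex P) F

      y⊑ : ∀ {v} → v ∈ y ∷ tabulate (vertex τ) → y ⊑ v
      y⊑ (here v≈y) = P.reflexive (Eq.sym v≈y)
      y⊑ (there v∈τ) with (i , v≈τᵢ) ← Membershipₚ.∈-tabulate⁻ Eq.setoid v∈τ =
        P.trans (y⊑τ i) (P.reflexive (Eq.sym v≈τᵢ))

      ∈-F : ∀ {v} → v ∈ F → v ≈ x ⊎ y ⊑ v
      ∈-F (here v≈x) = inj₁ v≈x
      ∈-F (there v∈) = inj₂ (y⊑ v∈)

      F-face : SimplicialComplex.Face (orderComplex P) F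
      F-face (here v≈x) _ = inj₁ (P.trans (P.reflexive v≈x) (minimum _))
      F-face _ (here v≈x) = inj₂ (P.trans (P.reflexive v≈x) (minimum _))
      F-face (there (here v≈y)) (there w∈) = inj₁ (P.trans (P.reflexive v≈y) (y⊑ w∈))
      F-face (there v∈) (there (here w≈y)) = inj₂ (P.trans (P.reflexive w≈y) (y⊑ v∈))
      F-face (there (there v∈τ)) (there (there w∈τ)) = isFace τ v∈τ w∈τ

      module _ {m} (σ : Simplex L m) where
        from-link : Simplex (orderComplex P) m
        from-link = record
          { vertex   = vertex σ
          ; distinct = distinct σ
          ; isFace   = λ v∈ w∈ → proj₂ (isFace σ)
              (Membershipₚ.∈-++⁺ʳ Eq.setoid F v∈) (Membershipₚ.∈-++⁺ʳ Eq.setoid F w∈) }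

        vertex-∉ : ∀ {v} i → v ∈ F → ¬ vertex σ i ≈ v
        vertex-∉ i v∈F p = proj₁ (isFace σ)
          (Membershipₚ.∈-resp-≈ Eq.setoid (Eq.sym p) v∈F
          , Membershipₚ.∈-tabulate⁺ Eq.setoid {f = vertex σ} i)

        vertex-comparable : ∀ {v} i → v ∈ F → Comparable (vertex σ i) v
        vertex-comparable i v∈F = proj₂ (isFace σ)
          (Membershipₚ.∈-++⁺ʳ Eq.setoid F (Membershipₚ.∈-tabulate⁺ Eq.setoid {f = vertex σ} i))
          (Membershipₚ.∈-++⁺ˡ Eq.setoid v∈F)

        τᵢ∈F : ∀ i → vertex τ i ∈ F
        τᵢ∈F i = there (there (Membershipₚ.∈-tabulate⁺ Eq.setoid {f = vertex τ} i))

        link-between : ∀ i → Between x y (vertex σ i)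
        link-between i = (minimum _ , vertex-∉ i (here Eq.refl) ∘ Eq.sym)
                       , below (vertex-comparable i (there (here Eq.refl)))
          where
          below : Comparable (vertex σ i) y → vertex σ i ⊏ y
          below (inj₁ σᵢ⊑y) = σᵢ⊑y , vertex-∉ i (there (here Eq.refl))
          -- Such a vertex is comparable with, and distinct from, every vertex of `τ`, so adjoining
          -- it would give a longer chain above `y`.
          below (inj₂ y⊑σᵢ) = contradiction
            ( cons (vertex σ i) τ (vertex-∉ i ∘ τᵢ∈F) (vertex-comparable i ∘ τᵢ∈F)
            , λ { zero → y⊑σᵢ ; (suc j) → y⊑τ j })
            τ-maximal

      to-link : ∀ {m} (σ : Simplex (orderComplex P) m) → (∀ i → Between x y (vertex σ i)) →
                Simplex L m
      to-link σ σ-between = record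
        { vertex   = vertex σ
        ; distinct = distinct σ
        ; isFace   = (λ (v∈F , v∈σ) → disjoint v∈F v∈σ)
                   , λ v∈ w∈ → face (Membershipₚ.∈-++⁻ Eq.setoid F v∈)
                                    (Membershipₚ.∈-++⁻ Eq.setoid F w∈) }
        where
        disjoint : ∀ {v} → v ∈ F → ¬ v ∈ tabulate (vertex σ)
        disjoint v∈F v∈σ with (i , v≈σᵢ) ← Membershipₚ.∈-tabulate⁻ Eq.setoid v∈σ
          with ∈-F v∈F | σ-between i
        ... | inj₁ v≈x | (_ , x≉σᵢ) , _ = x≉σᵢ (Eq.trans (Eq.sym v≈x) v≈σᵢ)
        ... | inj₂ y⊑v | _ , (σᵢ⊑y , σᵢ≉y) =
          σᵢ≉y (P.antisym σᵢ⊑y (P.trans y⊑v (P.reflexive v≈σᵢ)))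

        mixed : ∀ {v w} → v ∈ F → w ∈ tabulate (vertex σ) → Comparable v w
        mixed v∈F w∈σ with (i , w≈σᵢ) ← Membershipₚ.∈-tabulate⁻ Eq.setoid w∈σ
          with ∈-F v∈F | σ-between i
        ... | inj₁ v≈x | _ = inj₁ (P.trans (P.reflexive v≈x) (minimum _))
        ... | inj₂ y⊑v | _ , (σᵢ⊑y , _) =
          inj₂ (P.trans (P.reflexive w≈σᵢ) (P.trans σᵢ⊑y y⊑v))

        face : ∀ {v w} → v ∈ F ⊎ v ∈ tabulate (vertex σ) → w ∈ F ⊎ w ∈ tabulate (vertex σ) →
               Comparable v w
        face (inj₁ v∈F) (inj₁ w∈F) = F-face v∈F w∈F
        face (inj₁ v∈F) (inj₂ w∈σ) = mixed v∈F w∈σ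
        face (inj₂ v∈σ) (inj₁ w∈F) = Sum.swap (mixed w∈F v∈σ)
        face (inj₂ v∈σ) (inj₂ w∈σ) = isFace σ v∈σ w∈σ

      point : ∀ v → Between x y v → Simplex L 1
      point v v-between = to-link
        (simplex (λ _ → v) (λ { {zero} {zero} _ → refl }) (λ _ _ → inj₁ P.refl))
        (λ _ → v-between)

      q-edge : (σ : Simplex L 2) → q (vertex σ zero) ≡ q (vertex σ (suc zero))
      q-edge σ with vertices-comparable (from-link σ) zero (suc zero)
      ... | inj₁ v⊑w = q-mono (link-between σ _) (link-between σ _) v⊑w
      ... | inj₂ w⊑v = sym (q-mono (link-between σ _) (link-between σ _) w⊑v)

-- Words of reflections

-- A missed value could be adjoined to `f`, giving an injection from n + 1 elements into n.
injective⇒surjective : ∀ {n} {f : Fin n → Fin n} → Injective _≡_ _≡_ f → ∀ y → ∃ λ x → f x ≡ y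
injective⇒surjective {n} {f} f-injective y with Fin.any? (λ x → f x Fin.≟ y)
... | yes hit  = hit
... | no  miss = contradiction (Fin.injective⇒≤ g-injective) ℕ.1+n≰n
  where
  g : Fin (suc n) → Fin n
  g zero    = y
  g (suc x) = f x
  g-injective : Injective _≡_ _≡_ g
  g-injective {zero}  {zero}  _ = refl
  g-injective {zero}  {suc x} p = contradiction (x , sym p) miss
  g-injective {suc x} {zero}  p = contradiction (x , p) miss
  g-injective {suc x} {suc z} p = cong suc (f-injective p)

funToFin-cong : ∀ {m n} {f g : Fin m → Fin n} → f ≗ g → funToFin f ≡ funToFin g
funToFin-cong {zero}  f≗g = refl
funToFin-cong {suc m} f≗g = cong₂ combine (f≗g zero) (funToFin-cong (f≗g ∘ suc))

funToFin-injective : ∀ {m n} {f g : Fin m → Fin n} → funToFin f ≡ funToFin g → f ≗ g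
funToFin-injective {f = f} {g} p i = trans (sym (Fin.finToFun-funToFin f i))
  (trans (cong (λ c → finToFun c i) p) (Fin.finToFun-funToFin g i))

-- Subtraction in ℤ/3.
infixl 6 _⊖_
_⊖_ : Fin 3 → Fin 3 → Fin 3
x  ⊖ 0F = x
0F ⊖ 1F = 2F
1F ⊖ 1F = 0F
2F ⊖ 1F = 1F
0F ⊖ 2F = 1F
1F ⊖ 2F = 2F
2F ⊖ 2F = 0F

⊖≡0⇒≡ : ∀ x y → x ⊖ y ≡ 0F → x ≡ y
⊖≡0⇒≡ = from-yes (Fin.all? λ x → Fin.all? λ y → (x ⊖ y Fin.≟ 0F) →-dec (x Fin.≟ y))

⊖-interchange : ∀ w x y z → w ⊖ x ≡ y ⊖ z → (w ⊖ y) ⊖ (x ⊖ z) ≡ 0F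
⊖-interchange = from-yes (Fin.all? λ w → Fin.all? λ x → Fin.all? λ y → Fin.all? λ z →
  (w ⊖ x Fin.≟ y ⊖ z) →-dec ((w ⊖ y) ⊖ (x ⊖ z) Fin.≟ 0F))

⊖-neg : ∀ x y → (0F ⊖ x) ⊖ (0F ⊖ y) ≡ 0F ⊖ (x ⊖ y)
⊖-neg = from-yes (Fin.all? λ x → Fin.all? λ y → (0F ⊖ x) ⊖ (0F ⊖ y) Fin.≟ 0F ⊖ (x ⊖ y))

-- 2 is invertible modulo 3; modulo 2, negation would be the identity.
neg-fixed⇒0 : ∀ x → 0F ⊖ x ≡ x → x ≡ 0F
neg-fixed⇒0 = from-yes (Fin.all? λ x → (0F ⊖ x Fin.≟ x) →-dec (x Fin.≟ 0F))

-- Standard basis vectors of (ℤ/3)ᵏ, with a recursion that matches that of `coefficients`.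
indicator : ∀ {k} → Fin k → Fin k → Fin 3
indicator zero    zero    = 1F
indicator zero    (suc _) = 0F
indicator (suc l) zero    = 0F
indicator (suc l) (suc m) = indicator l m

module _ {n : ℕ} where

  product : ∀ {k} → Vec (Reflection n) k → DPerm n
  product rs = Vec.foldr′ _∙ᴰ_ εᴰ (Vec.map 𝒯 rs)

  -- Odd functions stand for vectors in (ℤ/3)ⁿ.
  Odd : (Signed n → Fin 3) → Set
  Odd f = ∀ x → f (neg x) ≡ 0F ⊖ f x

  odd-∘ : ∀ {f} (w : SignedPerm n) → Odd f → Odd (f ∘ (w $_))
  odd-∘ {f} w f-odd x = trans (cong f (odd w x)) (f-odd (w $ x))

  i⁺ j± : Reflection n → Signed n
  i⁺ r = Sign.+ , Reflection.i r
  j± r = Reflection.s r , Reflection.j r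

  swap-invariant : ∀ {f : Signed n → Fin 3} a b → f a ≡ f b → ∀ x → f (swap a b x) ≡ f x
  swap-invariant a b fa≡fb x with x ≟ₛ a | x ≟ₛ b
  ... | yes refl | _        = sym fa≡fb
  ... | no _     | yes refl = fa≡fb
  ... | no _     | no _     = refl

  -- Here f is orthogonal to the root of r. By oddness f also agrees at -i and at -(s j), so both
  -- transpositions that make up r preserve it.
  reflection-invariant : ∀ {f} r → Odd f → f (j± r) ⊖ f (i⁺ r) ≡ 0F → ∀ x → f (⟦ r ⟧ᵀ $ x) ≡ f x
  reflection-invariant {f} r f-odd fj-fi x = trans
    (swap-invariant {f} (i⁺ r) (j± r) fi≡fj (swap (neg (i⁺ r)) (neg (j± r)) x))
    (swap-invariant {f} (neg (i⁺ r)) (neg (j± r))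
      (trans (f-odd (i⁺ r)) (trans (cong (0F ⊖_) fi≡fj) (sym (f-odd (j± r))))) x)
    where
    fi≡fj : f (i⁺ r) ≡ f (j± r)
    fi≡fj = sym (⊖≡0⇒≡ _ _ fj-fi)

  -- f ∘ product rs − f is the combination of the roots of rs with these
  -- coefficients.
  coefficients : ∀ {k} → Vec (Reflection n) k → (Signed n → Fin 3) → Fin k → Fin 3
  coefficients (r ∷ rs) f zero    = f (j± r) ⊖ f (i⁺ r)
  coefficients (r ∷ rs) f (suc l) = coefficients rs (f ∘ (⟦ r ⟧ᵀ $_)) l

  coefficients-0⇒invariant : ∀ {k} (rs : Vec (Reflection n) k) {f} → Odd f →
    (∀ l → coefficients rs f l ≡ 0F) → ∀ x → f (elt (product rs) $ x) ≡ f x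
  coefficients-0⇒invariant []       f-odd _  x = refl
  coefficients-0⇒invariant (r ∷ rs) f-odd c₀ x = trans
    (coefficients-0⇒invariant rs (odd-∘ ⟦ r ⟧ᵀ f-odd) (c₀ ∘ suc) x)
    (reflection-invariant r f-odd (c₀ zero) x)

  coefficients-⊖ : ∀ {k} (rs : Vec (Reflection n) k) {f g} →
    coefficients rs f ≗ coefficients rs g → ∀ l → coefficients rs (λ x → f x ⊖ g x) l ≡ 0F
  coefficients-⊖ (r ∷ rs) {f} {g} p zero    =
    ⊖-interchange (f (j± r)) (f (i⁺ r)) (g (j± r)) (g (i⁺ r)) (p zero)
  coefficients-⊖ (r ∷ rs)         p (suc l) = coefficients-⊖ rs (p ∘ suc) l

  -- By linearity h = f - g has zero coefficients and is therefore invariant under the product.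
  -- Where the product negates x, this gives h x = -h x.
  coefficients-injective : ∀ {k} (rs : Vec (Reflection n) k) {f g} → Odd f → Odd g →
    coefficients rs f ≗ coefficients rs g →
    ∀ x → elt (product rs) $ x ≡ neg x → f x ≡ g x
  coefficients-injective rs {f} {g} f-odd g-odd p x negated =
    ⊖≡0⇒≡ (f x) (g x) (neg-fixed⇒0 (h x) (trans (sym (h-odd x)) (trans (cong h (sym negated))
      (coefficients-0⇒invariant rs h-odd (coefficients-⊖ rs p) x))))
    where
    h : Signed n → Fin 3
    h x = f x ⊖ g x
    h-odd : Odd h
    h-odd x = trans (cong₂ _⊖_ (f-odd x) (g-odd x)) (⊖-neg (f x) (g x))

  -- Reflections before position `l` have coefficient 0 and fix f; those after it have coefficient 0
  -- and fix f ∘ r. Only the reflection at `l` changes f, and its coefficient can be read off from f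
  -- itself.
  indicator-coefficients : ∀ {k} (rs : Vec (Reflection n) k) l {f} → Odd f →
    coefficients rs f ≗ indicator l → let r = lookup rs l in
    f (j± r) ⊖ f (i⁺ r) ≡ 1F × (∀ x → f (elt (product rs) $ x) ≡ f (⟦ r ⟧ᵀ $ x))
  indicator-coefficients (r ∷ rs) zero    f-odd p =
    p zero , coefficients-0⇒invariant rs (odd-∘ ⟦ r ⟧ᵀ f-odd) (p ∘ suc)
  indicator-coefficients (r ∷ rs) (suc l) {f} f-odd p
    with (q , h) ← indicator-coefficients rs l (odd-∘ ⟦ r ⟧ᵀ f-odd) (p ∘ suc) =
    trans (sym (cong₂ _⊖_ (invariant _) (invariant _))) q , λ x → trans (h x) (invariant _)
    where
    invariant : ∀ x → f (⟦ r ⟧ᵀ $ x) ≡ f x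
    invariant = reflection-invariant r f-odd (p zero)

  reflection-i : ∀ r → ⟦ r ⟧ᵀ $ i⁺ r ≡ j± r
  reflection-i r@(reflection i<j s) = trans
    (cong (swap (i⁺ r) (j± r)) (swap-fix (neg (i⁺ r)) (neg (j± r))
      (neg≢ (i⁺ r) ∘ sym) (Fin.<⇒≢ i<j ∘ cong proj₂)))
    (swap-left (i⁺ r) (j± r))

  reflection-j : ∀ r → ⟦ r ⟧ᵀ $ j± r ≡ i⁺ r
  reflection-j r@(reflection i<j s) = trans
    (cong (swap (i⁺ r) (j± r)) (swap-fix (neg (i⁺ r)) (neg (j± r))
      (Fin.<⇒≢ i<j ∘ sym ∘ cong proj₂) (neg≢ (j± r) ∘ sym)))
    (swap-right (i⁺ r) (j± r))

-- Counting over ℤ/3 for words equal to [1]⋯[m]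

module _ {m n : ℕ} where

  -- [1]⋯[m] in Bₘ₊ₙ.
  record NegatesFirst (w : DPerm (m + n)) : Set where
    field
      negates : ∀ i → elt w $ (Sign.+ , i ↑ˡ n) ≡ (Sign.- , i ↑ˡ n)
      fixes   : ∀ i → elt w $ (Sign.+ , m ↑ʳ i) ≡ (Sign.+ , m ↑ʳ i)
  open NegatesFirst

  -- An indexed family, so that matching on it rewrites both indices of the reflection as images of
  -- `Fin m`.
  data Supported : Reflection (m + n) → Set where
    supported : ∀ i j (i<j : i ↑ˡ n Fin.< j ↑ˡ n) s → Supported (reflection i<j s)

  -- A vector on the first m coordinates, extended by zero to an odd function.
  extend : (Fin m → Fin 3) → Signed (m + n) → Fin 3
  extend t (Sign.+ , i) = [ t , const 0F ]′ (splitAt m i)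
  extend t (Sign.- , i) = 0F ⊖ [ t , const 0F ]′ (splitAt m i)

  extend-odd : ∀ t → Odd (extend t)
  extend-odd t (Sign.+ , i) = refl
  extend-odd t (Sign.- , i) = ⊖-involutive _
    where
    ⊖-involutive : ∀ x → x ≡ 0F ⊖ (0F ⊖ x)
    ⊖-involutive = from-yes (Fin.all? λ x → x Fin.≟ 0F ⊖ (0F ⊖ x))

  extend-inside : ∀ t i → extend t (Sign.+ , i ↑ˡ n) ≡ t i
  extend-inside t i = cong [ t , const 0F ]′ (Fin.splitAt-↑ˡ m i n)

  extend-outside : ∀ t s i → extend t (s , m ↑ʳ i) ≡ 0F
  extend-outside t Sign.+ i = cong [ t , const 0F ]′ (Fin.splitAt-↑ʳ m n i)
  extend-outside t Sign.- i = cong (0F ⊖_) (extend-outside t Sign.+ i)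

  module _ {w : DPerm (m + n)} (w-negates : NegatesFirst w) {k}
           (rs : Vec (Reflection (m + n)) k) (w≈rs : w ≈ᴰ product rs) where
    private
      encode : Fin (3 ^ m) → Fin (3 ^ k)
      encode c = funToFin (coefficients rs (extend (finToFun {3} {m} c)))

      encode-injective : Injective _≡_ _≡_ encode
      encode-injective {c} {d} p = begin
        c                             ≡⟨ Fin.funToFin-finToFin {m} c ⟨
        funToFin (finToFun {3} {m} c) ≡⟨ funToFin-cong same ⟩
        funToFin (finToFun {3} {m} d) ≡⟨ Fin.funToFin-finToFin {m} d ⟩
        d                             ∎
        where
        open ≡-Reasoning
        same : finToFun {3} {m} c ≗ finToFun d
        same i = trans (sym (extend-inside (finToFun c) i)) (trans
          (coefficients-injective rs (extend-odd (finToFun c)) (extend-odd (finToFun d))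
            (funToFin-injective {f = coefficients rs _} p) (Sign.+ , i ↑ˡ n)
            (trans (sym (at (elt≈ w≈rs) _)) (negates w-negates i)))
          (extend-inside (finToFun d) i))

    -- Coefficients determine a vector on the negated coordinates, so `encode` embeds a set of size
    -- 3ᵐ into one of size 3ᵏ.
    NegatesFirst⇒length≥ : m ≤ k
    NegatesFirst⇒length≥ = ℕ.≮⇒≥ λ k<m →
      ℕ.≤⇒≯ (Fin.injective⇒≤ encode-injective) (ℕ.^-monoʳ-< 3 (s≤s (s≤s z≤n)) k<m)

    private
      -- For k = m the injection `encode` is onto, so every basis vector occurs as a coefficient
      -- vector.
      vector : k ≡ m → ∀ l → ∃ λ t → coefficients rs (extend t) ≗ indicator l
      vector refl l =
        let (c , p) = injective⇒surjective {f = encode} encode-injective (funToFin (indicator l))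
        in finToFun {3} {m} c , funToFin-injective {f = coefficients rs _} p

      fixes± : ∀ s i → elt w $ (s , m ↑ʳ i) ≡ (s , m ↑ʳ i)
      fixes± Sign.+ i = fixes w-negates i
      fixes± Sign.- i = trans (odd (elt w) _) (cong neg (fixes w-negates i))

    -- Choose f with coefficient vector `indicator l`; then f ∘ w = f ∘ r, which vanishes outside
    -- the first m coordinates. If r moved an outside coordinate, f would vanish at both i and s j,
    -- contradicting a difference of 1.
    NegatesFirst⇒supported : k ≡ m → ∀ l → Supported (lookup rs l)
    NegatesFirst⇒supported k≡m l =
      let (t , p) = vector k≡m l
          r = lookup rs l
          (difference , same) = indicator-coefficients rs l (extend-odd t) p
          vanishes : ∀ s i → extend t (⟦ r ⟧ᵀ $ (s , m ↑ʳ i)) ≡ 0F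
          vanishes s i = trans (sym (same (s , m ↑ʳ i))) (trans
            (cong (extend t) (trans (sym (at (elt≈ w≈rs) (s , m ↑ʳ i))) (fixes± s i)))
            (extend-outside t s i))
      in support t r difference vanishes
      where
      support : ∀ t r → extend t (j± r) ⊖ extend t (i⁺ r) ≡ 1F →
        (∀ s i → extend t (⟦ r ⟧ᵀ $ (s , m ↑ʳ i)) ≡ 0F) → Supported r
      support t r@(reflection {i} {j} i<j s) difference vanishes =
        split i j i<j (splitAt m i) (splitAt m j) (Fin.join-splitAt m n i) (Fin.join-splitAt m n j)
          difference vanishes
        where
        equal : ∀ {x y} → x ≡ 0F → y ≡ 0F → ¬ x ⊖ y ≡ 1F
        equal refl refl ()
        split : ∀ i j (i<j : i Fin.< j) x y → Fin.join m n x ≡ i → Fin.join m n y ≡ j →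
          extend t (s , j) ⊖ extend t (Sign.+ , i) ≡ 1F →
          (∀ s′ i′ → extend t (⟦ reflection i<j s ⟧ᵀ $ (s′ , m ↑ʳ i′)) ≡ 0F) →
          Supported (reflection i<j s)
        split _ _ i<j (inj₁ i) (inj₁ j) refl refl _ _ = supported i j i<j s
        split _ j i<j (inj₂ i) _ refl _ difference vanishes = contradiction difference
          (equal (trans (cong (extend t) (sym (reflection-i (reflection i<j s)))) (vanishes Sign.+ i))
                 (extend-outside t Sign.+ i))
        split i _ i<j (inj₁ _) (inj₂ j) _ refl difference vanishes = contradiction difference
          (equal (extend-outside t s j)
                 (trans (cong (extend t) (sym (reflection-j (reflection i<j s)))) (vanishes s j)))

-- Factorisations in D₄

module _ {n : ℕ} where
  point : Fin 4 → Signed (4 + n)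
  point i = Sign.+ , i ↑ˡ n

  -- The action of ((i, s j)), free of a proof that i < j so that the finite checks can evaluate it;
  -- it agrees with `⟦_⟧ᵀ` by definition.
  paired-action : Fin 4 → Fin 4 → Sign → Signed (4 + n) → Signed (4 + n)
  paired-action i j s =
    swap (Sign.+ , i ↑ˡ n) (s , j ↑ˡ n) ∘ swap (Sign.- , i ↑ˡ n) (opposite s , j ↑ˡ n)

  all-paired? : ∀ {p} {P : Fin 4 → Fin 4 → Sign → Set p} → (∀ i j s → Dec (P i j s)) →
                Dec (∀ i j → i Fin.< j → ∀ s → P i j s)
  all-paired? P? = Fin.all? λ i → Fin.all? λ j → (i Fin.<? j) →-dec
    map′ (λ { (p , q) Sign.+ → p ; (p , q) Sign.- → q }) (λ f → f Sign.+ , f Sign.-)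
      (P? i j Sign.+ ×-dec P? i j Sign.-)

  -- For f in D₄: whether f lies in the subgroup generated by the four mutually
  -- orthogonal reflections ((1,±2)), ((3,±4)).
  preserves-12∣34 : (Signed (4 + n) → Signed (4 + n)) → Bool
  preserves-12∣34 f = does
    ((f (point 1F) ≟ₛ paired-action 0F 1F Sign.+ (f (point 0F))) ×-dec
     (f (point 3F) ≟ₛ paired-action 2F 3F Sign.+ (f (point 2F))))

  preserves-12∣34-cong : ∀ {f g} → f ≗ g → preserves-12∣34 f ≡ preserves-12∣34 g
  preserves-12∣34-cong {f} {g} f≗g
    rewrite f≗g (point 0F) | f≗g (point 1F) | f≗g (point 2F) | f≗g (point 3F) = refl

  -- If h = −r for a reflection r then h is an involution without fixed points
  -- among ±1,…,±4; h is the product of three reflections with prefixes f and g.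
  -- A record, so that Agda compares f, g and h without unfolding PrefixesAgree.
  record PrefixesAgree (f g h : Signed (4 + n) → Signed (4 + n)) : Set where
    constructor prefixes-agree
    field
      agree : (∀ x → h (h (point x)) ≡ point x) → (∀ x → h (point x) ≢ point x) →
        preserves-12∣34 f ≡ preserves-12∣34 g × preserves-12∣34 g ≡ preserves-12∣34 h

  prefixesAgree? : ∀ f g h → Dec (PrefixesAgree f g h)
  prefixesAgree? f g h = map′ prefixes-agree PrefixesAgree.agree (
    Fin.all? (λ x → h (h (point x)) ≟ₛ point x) →-dec
    (Fin.all? (λ x → ¬? (h (point x) ≟ₛ point x)) →-dec
    ((preserves-12∣34 f Bool.≟ preserves-12∣34 g) ×-dec
     (preserves-12∣34 g Bool.≟ preserves-12∣34 h))))

  TripleAgrees : (i₁ j₁ : Fin 4) (s₁ : Sign) (i₂ j₂ : Fin 4) (s₂ : Sign)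
                 (i₃ j₃ : Fin 4) (s₃ : Sign) → Set
  TripleAgrees i₁ j₁ s₁ i₂ j₂ s₂ i₃ j₃ s₃ = PrefixesAgree f (f ∘ g) (f ∘ g ∘ h)
    where
    f g h : Signed (4 + n) → Signed (4 + n)
    f = paired-action i₁ j₁ s₁
    g = paired-action i₂ j₂ s₂
    h = paired-action i₃ j₃ s₃

  tripleAgrees? : ∀ i₁ j₁ s₁ i₂ j₂ s₂ i₃ j₃ s₃ → Dec (TripleAgrees i₁ j₁ s₁ i₂ j₂ s₂ i₃ j₃ s₃)
  tripleAgrees? i₁ j₁ s₁ i₂ j₂ s₂ i₃ j₃ s₃ = prefixesAgree? _ _ _

  TriplesAgree : Set
  TriplesAgree =
    ∀ i₁ j₁ → i₁ Fin.< j₁ → ∀ s₁ i₂ j₂ → i₂ Fin.< j₂ → ∀ s₂ i₃ j₃ → i₃ Fin.< j₃ → ∀ s₃ →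
    TripleAgrees i₁ j₁ s₁ i₂ j₂ s₂ i₃ j₃ s₃

  triplesAgree? : Dec TriplesAgree
  triplesAgree? = all-paired? λ i₁ j₁ s₁ → all-paired? λ i₂ j₂ s₂ → all-paired? λ i₃ j₃ s₃ →
    tripleAgrees? i₁ j₁ s₁ i₂ j₂ s₂ i₃ j₃ s₃

  -- Settled by evaluating all 12³ triples. `n` can remain a variable because only images of the
  -- first four points are inspected.
  triples-agree : TriplesAgree
  triples-agree = from-yes triplesAgree?

  -- The facts needed about the last reflection r₄: by `stays`, u acts as -1 on r₄x; by `not-neg`,
  -- -r₄ does not fix x.
  record PairedImage (f : Signed (4 + n) → Signed (4 + n)) (x : Fin 4) : Set where
    constructor paired-image
    field
      stays   : ∃₂ λ s k → f (point x) ≡ (s , k ↑ˡ n)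
      not-neg : neg (f (point x)) ≢ point x

  pairedImage? : ∀ f x → Dec (PairedImage f x)
  pairedImage? f x = map′
    (λ (p , q) → paired-image p q)
    (λ p → PairedImage.stays p , PairedImage.not-neg p)
    (any-signed? (λ s k → f (point x) ≟ₛ (s , k ↑ˡ n)) ×-dec ¬? (neg (f (point x)) ≟ₛ point x))
    where
    any-signed? : {P : Sign → Fin 4 → Set} → (∀ s k → Dec (P s k)) → Dec (∃₂ P)
    any-signed? P? = map′ (λ { (k , inj₁ p) → Sign.+ , k , p ; (k , inj₂ p) → Sign.- , k , p })
      (λ { (Sign.+ , k , p) → k , inj₁ p ; (Sign.- , k , p) → k , inj₂ p })
      (Fin.any? λ k → P? Sign.+ k ⊎-dec P? Sign.- k)

  PairedImages : Set
  PairedImages = ∀ i j → i Fin.< j → ∀ s x → PairedImage (paired-action i j s) x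

  pairedImages? : Dec PairedImages
  pairedImages? = all-paired? λ i j s → Fin.all? λ x → pairedImage? (paired-action i j s) x

  paired-images : PairedImages
  paired-images = from-yes pairedImages?

-- The interval below [1][2][3][4]

module _ {n : ℕ} where
  open Group (D n) using (_∙_; ε; _⁻¹; _≈_; ∙-congˡ; identityʳ)
  private module D = Group (D n)
  open GroupProperties (D n) using (\\-leftDividesˡ; \\-leftDividesʳ)

  ≈-on-positives : ∀ {v w : DPerm n} → (∀ i → elt v $ (Sign.+ , i) ≡ elt w $ (Sign.+ , i)) → v ≈ w
  ≈-on-positives {v} {w} p = mk≈ᴰ (pointwise λ where
    (Sign.+ , i) → p i
    (Sign.- , i) → trans (odd (elt v) (Sign.+ , i))
      (trans (cong neg (p i)) (sym (odd (elt w) (Sign.+ , i)))))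

  ≼-length : ∀ {v w : DPerm n} → v ≼ w → ℓ𝒯 v ≤ ℓ𝒯 w
  ≼-length {v} p = subst (ℓ𝒯 v ≤_) p (ℕ.m≤m+n (ℓ𝒯 v) _)

  ≼-length-injective : ∀ {v w : DPerm n} → v ≼ w → ℓ𝒯 v ≡ ℓ𝒯 w → v ≈ w
  ≼-length-injective {v} {w} p ℓv≡ℓw = begin
    v                ≈⟨ identityʳ v ⟨
    v ∙ ε            ≈⟨ ∙-congˡ {v} (ℓ≡0⇒≈ε (v ⁻¹ ∙ w) gap) ⟨
    v ∙ (v ⁻¹ ∙ w)   ≈⟨ \\-leftDividesˡ v w ⟩
    w                ∎
    where
    open SetoidReasoning D.setoid
    gap : ℓ𝒯 (v ⁻¹ ∙ w) ≡ 0
    gap = ℕ.+-cancelˡ-≡ (ℓ𝒯 v) _ _ (trans p (trans (sym ℓv≡ℓw) (sym (ℕ.+-identityʳ _))))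

  ε-≼ : ∀ (v : DPerm n) → ε ≼ v
  ε-≼ v = begin
    ℓ𝒯 ε + ℓ𝒯 (ε ⁻¹ ∙ v) ≡⟨ cong₂ _+_ ℓ-ε (ℓ-cong ε⁻¹∙v≈v) ⟩
    ℓ𝒯 v                 ∎
    where
    open ≡-Reasoning
    ℓ-ε : ℓ𝒯 ε ≡ 0
    ℓ-ε = ℕ.n≤0⇒n≡0 (ℓ-least ε ([] , D.refl))
    ε⁻¹∙v≈v : ε ⁻¹ ∙ v ≈ v
    ε⁻¹∙v≈v = mk≈ᴰ (pointwise λ _ → refl)

  Between-length : ∀ {u v : DPerm n} → v ≼ u → 0 < ℓ𝒯 v → ℓ𝒯 v < ℓ𝒯 u → Between (Abs n) ε u v
  Between-length {u} {v} v≼u 0<ℓv ℓv<ℓu =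
    (ε-≼ v , λ ε≈v → ℕ.<⇒≢ (ℕ.≤-<-trans (ℓ-least ε ([] , D.refl)) 0<ℓv) (ℓ-cong ε≈v)) ,
    (v≼u , λ v≈u → ℕ.<⇒≢ ℓv<ℓu (ℓ-cong v≈u))

  length-between : ∀ {u v : DPerm n} → Between (Abs n) ε u v → 0 < ℓ𝒯 v × ℓ𝒯 v < ℓ𝒯 u
  length-between {u} {v} ((_ , ε≉v) , (v≼u , v≉u)) =
    ℕ.n≢0⇒n>0 (λ ℓv≡0 → ε≉v (D.sym (ℓ≡0⇒≈ε v ℓv≡0))) ,
    ℕ.≤∧≢⇒< (≼-length {v} {u} v≼u) (λ p → v≉u (≼-length-injective {v} {u} v≼u p))

  product-++ : ∀ {a b} (rs : Vec (Reflection n) a) (ss : Vec (Reflection n) b) →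
    product rs ∙ product ss ≈ product (rs ++ ss)
  product-++ []       ss = D.identityˡ (product ss)
  product-++ (r ∷ rs) ss =
    D.trans (D.assoc (𝒯 r) (product rs) (product ss)) (∙-congˡ {𝒯 r} (product-++ rs ss))

  -- The factors have lengths at most `a` and `b`, while subadditivity makes the lengths sum to at
  -- least a + b; so both bounds are attained.
  prefix-≼ : ∀ {a b} (rs : Vec (Reflection n) a) (ss : Vec (Reflection n) b) {z} →
    product rs ∙ product ss ≈ z → ℓ𝒯 z ≡ a + b → ℓ𝒯 (product rs) ≡ a × product rs ≼ z
  prefix-≼ {a} {b} rs ss {z} rs∙ss≈z ℓz≡a+b =
    ℓv≡a , trans (cong₂ _+_ ℓv≡a (trans (ℓ-cong v⁻¹z≈w) ℓw≡b)) (sym ℓz≡a+b)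
    where
    v w : DPerm n
    v = product rs
    w = product ss
    ℓv≤a : ℓ𝒯 v ≤ a
    ℓv≤a = ℓ-least v (rs , D.refl)
    ℓw≤b : ℓ𝒯 w ≤ b
    ℓw≤b = ℓ-least w (ss , D.refl)
    a+b≤ : a + b ≤ ℓ𝒯 v + ℓ𝒯 w
    a+b≤ = subst (_≤ ℓ𝒯 v + ℓ𝒯 w) (trans (ℓ-cong rs∙ss≈z) ℓz≡a+b) (ℓ-∙ v w)
    ℓv≡a : ℓ𝒯 v ≡ a
    ℓv≡a = ℕ.≤-antisym ℓv≤a
      (ℕ.+-cancelʳ-≤ b a (ℓ𝒯 v) (ℕ.≤-trans a+b≤ (ℕ.+-monoʳ-≤ (ℓ𝒯 v) ℓw≤b)))
    ℓw≡b : ℓ𝒯 w ≡ b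
    ℓw≡b = ℕ.≤-antisym ℓw≤b
      (ℕ.+-cancelˡ-≤ a b (ℓ𝒯 w) (ℕ.≤-trans a+b≤ (ℕ.+-monoˡ-≤ (ℓ𝒯 w) ℓv≤a)))
    v⁻¹z≈w : v ⁻¹ ∙ z ≈ w
    v⁻¹z≈w = D.trans (∙-congˡ {v ⁻¹} (D.sym rs∙ss≈z)) (\\-leftDividesʳ v w)

  signed-index : Signed n → Fin n ⊎ Fin n
  signed-index (Sign.+ , i) = inj₁ i
  signed-index (Sign.- , i) = inj₂ i

  signed-index-injective : ∀ {x y} → signed-index x ≡ signed-index y → x ≡ y
  signed-index-injective {Sign.+ , i} {Sign.+ , _} refl = refl
  signed-index-injective {Sign.- , i} {Sign.- , _} refl = refl

  -- A crude count: an element is determined by its n values at the positive points, each among 2n.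
  Abs-bounded : ∀ m → Simplex (orderComplex (Abs n)) m → m ≤ (n + n) ^ n
  Abs-bounded m σ = Fin.injective⇒≤ {f = encode ∘ vertex σ} (distinct σ ∘ encode-injective)
    where
    values : DPerm n → Fin n → Fin (n + n)
    values v i = join n n (signed-index (elt v $ (Sign.+ , i)))
    encode : DPerm n → Fin ((n + n) ^ n)
    encode v = funToFin (values v)
    encode-injective : ∀ {v w} → encode v ≡ encode w → v ≈ w
    encode-injective {v} {w} p = ≈-on-positives λ i → signed-index-injective (trans
      (sym (Fin.splitAt-join n n _))
      (trans (cong (splitAt n) (funToFin-injective {f = values v} {values w} p i))
        (Fin.splitAt-join n n _)))

-- Factorisations of u and the components of (e, u)

module _ {n : ℕ} where
  private N = 4 + n
  open Group (D N) using (_∙_; ε; _⁻¹; _≈_)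
  private module D = Group (D N)

  t₁₂ t₁₃ t₂₄ t₃₄ : Sign → Reflection N
  t₁₂ = reflection {i = 0F} {1F} (s≤s z≤n)
  t₁₃ = reflection {i = 0F} {2F} (s≤s z≤n)
  t₂₄ = reflection {i = 1F} {3F} (s≤s (s≤s z≤n))
  t₃₄ = reflection {i = 2F} {3F} (s≤s (s≤s (s≤s z≤n)))

  word₁₂∣₃₄ word₁₃∣₂₄ : Vec (Reflection N) 4
  word₁₂∣₃₄ = t₁₂ Sign.+ ∷ t₁₂ Sign.- ∷ t₃₄ Sign.+ ∷ t₃₄ Sign.- ∷ []
  word₁₃∣₂₄ = t₁₃ Sign.+ ∷ t₁₃ Sign.- ∷ t₂₄ Sign.+ ∷ t₂₄ Sign.- ∷ []

  word-negates : NegatesFirst {4} {n} (product word₁₂∣₃₄)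
  word-negates = record
    { negates = λ { 0F → refl ; 1F → refl ; 2F → refl ; 3F → refl }
    ; fixes   = λ _ → refl }

  NegatesFirst-unique : ∀ {v w} → NegatesFirst {4} {n} v → NegatesFirst {4} {n} w → v ≈ w
  NegatesFirst-unique {v} {w} p q = ≈-on-positives λ where
      0F → same 0F
      1F → same 1F
      2F → same 2F
      3F → same 3F
      (suc (suc (suc (suc i)))) → trans (p.fixes i) (sym (q.fixes i))
    where
    module p = NegatesFirst p
    module q = NegatesFirst q
    same : ∀ i → elt v $ (Sign.+ , i ↑ˡ n) ≡ elt w $ (Sign.+ , i ↑ˡ n)
    same i = trans (p.negates i) (sym (q.negates i))

  -- Opaque because comparing words of reflections pointwise makes Agda unfold
  -- nested transpositions, at exponential cost.
  opaque
    side : DPerm N → Bool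
    side v = preserves-12∣34 (elt v $_)

    side≡ : ∀ v → side v ≡ preserves-12∣34 (elt v $_)
    side≡ _ = refl

    side-t₁₂ : side (product (t₁₂ Sign.+ ∷ [])) ≡ true
    side-t₁₂ = refl

    side-t₁₃ : side (product (t₁₃ Sign.+ ∷ [])) ≡ false
    side-t₁₃ = refl

  side-cong : ∀ {v w} → v ≈ w → side v ≡ side w
  side-cong {v} {w} p =
    trans (side≡ v) (trans (preserves-12∣34-cong (at (elt≈ p))) (sym (side≡ w)))

  module _ {u : DPerm N} (u-negates : NegatesFirst {4} {n} u) where
    open NegatesFirst u-negates

    u≈word₁₂∣₃₄ : u ≈ product word₁₂∣₃₄
    u≈word₁₂∣₃₄ = NegatesFirst-unique u-negates word-negates

    u≈word₁₃∣₂₄ : u ≈ product word₁₃∣₂₄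
    u≈word₁₃∣₂₄ = NegatesFirst-unique u-negates (record
      { negates = λ { 0F → refl ; 1F → refl ; 2F → refl ; 3F → refl }
      ; fixes   = λ _ → refl })

    -- The explicit word bounds the length above, the count over ℤ/3 below.
    ℓu≡4 : ℓ𝒯 u ≡ 4
    ℓu≡4 = ℕ.≤-antisym (ℓ-least u (word₁₂∣₃₄ , u≈word₁₂∣₃₄))
      (NegatesFirst⇒length≥ u-negates (proj₁ (ℓ-product u)) (proj₂ (ℓ-product u)))

    u-neg : ∀ s i → elt u $ (s , i ↑ˡ n) ≡ neg (s , i ↑ˡ n)
    u-neg Sign.+ i = negates i
    u-neg Sign.- i = trans (odd (elt u) (Sign.+ , i ↑ˡ n)) (cong neg (negates i))

    private
      -- The elements vᵢ and the functions fᵢ used in the finite check are both parameters, related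
      -- pointwise, so that no transposition unfolds in the calculation.
      module Factorisation (v₁ v₂ v₃ v₄ : DPerm N) {f₁ f₂ f₃ f₄ : Signed N → Signed N}
        (e₁ : ∀ x → f₁ x ≡ elt v₁ $ x) (e₂ : ∀ x → f₂ x ≡ elt v₂ $ x)
        (e₃ : ∀ x → f₃ x ≡ elt v₃ $ x) (e₄ : ∀ x → f₄ x ≡ elt v₄ $ x)
        (agree : PrefixesAgree f₁ (f₁ ∘ f₂) (f₁ ∘ f₂ ∘ f₃)) (image : ∀ x → PairedImage f₄ x)
        (v₄-involutive : ∀ x → elt v₄ $ (elt v₄ $ x) ≡ x)
        (u≈ : u ≈ v₁ ∙ (v₂ ∙ (v₃ ∙ (v₄ ∙ ε)))) where

        h : SignedPerm N
        h = elt (v₁ ∙ (v₂ ∙ (v₃ ∙ ε)))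

        h∘v₄ : ∀ x → h $ (elt v₄ $ x) ≡ elt u $ x
        h∘v₄ x = sym (at (elt≈ u≈) x)

        -- As u = h v₄ and v₄ is an involution, h = u v₄; and v₄ keeps these points where u is -1.
        h≡-v₄ : ∀ x → h $ point x ≡ neg (elt v₄ $ point x)
        h≡-v₄ x with (s , k , p) ← PairedImage.stays (image x) = begin
          h $ point x                       ≡⟨ cong (h $_) (v₄-involutive (point x)) ⟨
          h $ (elt v₄ $ (elt v₄ $ point x)) ≡⟨ h∘v₄ (elt v₄ $ point x) ⟩
          elt u $ (elt v₄ $ point x)        ≡⟨ cong (elt u $_) v₄x≡ ⟩
          elt u $ (s , k ↑ˡ n)              ≡⟨ u-neg s k ⟩
          neg (s , k ↑ˡ n)                  ≡⟨ cong neg v₄x≡ ⟨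
          neg (elt v₄ $ point x)            ∎
          where
          open ≡-Reasoning
          v₄x≡ : elt v₄ $ point x ≡ (s , k ↑ˡ n)
          v₄x≡ = trans (sym (e₄ (point x))) p

        h-involutive : ∀ x → h $ (h $ point x) ≡ point x
        h-involutive x = begin
          h $ (h $ point x)              ≡⟨ cong (h $_) (h≡-v₄ x) ⟩
          h $ neg (elt v₄ $ point x)     ≡⟨ odd h (elt v₄ $ point x) ⟩
          neg (h $ (elt v₄ $ point x))   ≡⟨ cong neg (h∘v₄ (point x)) ⟩
          neg (elt u $ point x)          ≡⟨ cong neg (negates x) ⟩
          point x                        ∎
          where open ≡-Reasoning

        h-fixes-none : ∀ x → h $ point x ≢ point x
        h-fixes-none x hx≡x = PairedImage.not-neg (image x)
          (trans (cong neg (e₄ (point x))) (trans (sym (h≡-v₄ x)) hx≡x))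

        f₁₂≗ : ∀ x → f₁ (f₂ x) ≡ elt v₁ $ (elt v₂ $ x)
        f₁₂≗ x = trans (e₁ (f₂ x)) (cong (elt v₁ $_) (e₂ x))

        f₁₂₃≗ : ∀ x → f₁ (f₂ (f₃ x)) ≡ h $ x
        f₁₂₃≗ x = trans (f₁₂≗ (f₃ x)) (cong (λ y → elt v₁ $ (elt v₂ $ y)) (e₃ x))

        sides : side (v₁ ∙ ε) ≡ side (v₁ ∙ (v₂ ∙ ε)) ×
                side (v₁ ∙ (v₂ ∙ ε)) ≡ side (v₁ ∙ (v₂ ∙ (v₃ ∙ ε)))
        sides =
          let (p , q) = PrefixesAgree.agree agree
                (λ x → trans (f₁₂₃≗ _) (trans (cong (h $_) (f₁₂₃≗ (point x))) (h-involutive x)))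
                (λ x hx≡x → h-fixes-none x (trans (sym (f₁₂₃≗ (point x))) hx≡x))
          in trans (as-side (v₁ ∙ ε) e₁) (trans p (sym (as-side (v₁ ∙ (v₂ ∙ ε)) f₁₂≗))) ,
             trans (as-side (v₁ ∙ (v₂ ∙ ε)) f₁₂≗)
               (trans q (sym (as-side (v₁ ∙ (v₂ ∙ (v₃ ∙ ε))) f₁₂₃≗)))
          where
          as-side : ∀ v {f} → (∀ x → f x ≡ elt v $ x) → side v ≡ preserves-12∣34 f
          as-side v f≗v = trans (side≡ v) (sym (preserves-12∣34-cong f≗v))

    -- A word of length 4 for u uses only reflections of the first four coordinates, which reduces
    -- the claim to the finite check in D₄.
    side-prefixes : ∀ r₁ r₂ r₃ r₄ → u ≈ product (r₁ ∷ r₂ ∷ r₃ ∷ r₄ ∷ []) →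
      side (product (r₁ ∷ [])) ≡ side (product (r₁ ∷ r₂ ∷ [])) ×
      side (product (r₁ ∷ r₂ ∷ [])) ≡ side (product (r₁ ∷ r₂ ∷ r₃ ∷ []))
    side-prefixes r₁ r₂ r₃ r₄ u≈ =
      go (is-supported 0F) (is-supported 1F) (is-supported 2F) (is-supported 3F) u≈
      where
      is-supported : ∀ l → Supported (lookup (r₁ ∷ r₂ ∷ r₃ ∷ r₄ ∷ []) l)
      is-supported = NegatesFirst⇒supported u-negates (r₁ ∷ r₂ ∷ r₃ ∷ r₄ ∷ []) u≈ refl

      narrow : ∀ {i j : Fin 4} → i ↑ˡ n Fin.< j ↑ˡ n → i Fin.< j
      narrow {i} {j} = subst₂ _<_ (Fin.toℕ-↑ˡ i n) (Fin.toℕ-↑ˡ j n)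

      𝒯-action : ∀ i j (i<j : i ↑ˡ n Fin.< j ↑ˡ n) s x →
        paired-action i j s x ≡ ⟦ reflection i<j s ⟧ᵀ $ x
      𝒯-action i j i<j s x = refl

      go : ∀ {r₁ r₂ r₃ r₄} → Supported r₁ → Supported r₂ → Supported r₃ → Supported r₄ →
        u ≈ product (r₁ ∷ r₂ ∷ r₃ ∷ r₄ ∷ []) →
        side (product (r₁ ∷ [])) ≡ side (product (r₁ ∷ r₂ ∷ [])) ×
        side (product (r₁ ∷ r₂ ∷ [])) ≡ side (product (r₁ ∷ r₂ ∷ r₃ ∷ []))
      go {r₁} {r₂} {r₃} {r₄} (supported i₁ j₁ p₁ s₁) (supported i₂ j₂ p₂ s₂)
        (supported i₃ j₃ p₃ s₃) (supported i₄ j₄ p₄ s₄) u≈ =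
        Factorisation.sides (𝒯 r₁) (𝒯 r₂) (𝒯 r₃) (𝒯 r₄)
          (𝒯-action i₁ j₁ p₁ s₁) (𝒯-action i₂ j₂ p₂ s₂)
          (𝒯-action i₃ j₃ p₃ s₃) (𝒯-action i₄ j₄ p₄ s₄)
          (triples-agree i₁ j₁ (narrow p₁) s₁ i₂ j₂ (narrow p₂) s₂ i₃ j₃ (narrow p₃) s₃)
          (paired-images i₄ j₄ (narrow p₄) s₄)
          -- A reflection is by definition its own inverse map, so this states involutivity.
          ($⁻¹-$ ⟦ r₄ ⟧ᵀ)
          u≈

    side-++ : ∀ {a b c} (rs : Vec (Reflection N) a) (ss : Vec (Reflection N) b)
      (ts : Vec (Reflection N) c) → 0 < a → 0 < c → a + (b + c) ≡ 4 →
      u ≈ product (rs ++ (ss ++ ts)) → side (product rs) ≡ side (product (rs ++ ss))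
    side-++ rs [] _ _ _ _ _ =
      side-cong (D.trans (D.sym (D.identityʳ (product rs))) (product-++ rs []))
    -- For nonempty `ss` the possible lengths are (1,1,2), (1,2,1) and (2,1,1); the total 4 refutes
    -- all other clauses.
    side-++ (r₁ ∷ []) (r₂ ∷ []) (r₃ ∷ r₄ ∷ []) _ _ _ u≈ = proj₁ (side-prefixes r₁ r₂ r₃ r₄ u≈)
    side-++ (r₁ ∷ []) (r₂ ∷ r₃ ∷ []) (r₄ ∷ []) _ _ _ u≈ =
      let (p , q) = side-prefixes r₁ r₂ r₃ r₄ u≈ in trans p q
    side-++ (r₁ ∷ r₂ ∷ []) (r₃ ∷ []) (r₄ ∷ []) _ _ _ u≈ = proj₂ (side-prefixes r₁ r₂ r₃ r₄ u≈)
    side-++ (_ ∷ []) (_ ∷ _ ∷ []) (_ ∷ _ ∷ _) _ _ () _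
    side-++ (_ ∷ []) (_ ∷ _ ∷ _ ∷ []) (_ ∷ _) _ _ () _
    side-++ (_ ∷ []) (_ ∷ _ ∷ _ ∷ _ ∷ _) _ _ _ () _
    side-++ (_ ∷ _ ∷ []) (_ ∷ _ ∷ []) (_ ∷ _) _ _ () _
    side-++ (_ ∷ _ ∷ []) (_ ∷ _ ∷ _ ∷ _) (_ ∷ _) _ _ () _
    side-++ (_ ∷ _ ∷ _ ∷ []) (_ ∷ []) (_ ∷ _) _ _ () _
    side-++ (_ ∷ _ ∷ _ ∷ []) (_ ∷ _ ∷ _) (_ ∷ _) _ _ () _
    side-++ (_ ∷ _ ∷ _ ∷ _ ∷ []) (_ ∷ _) (_ ∷ _) _ _ () _
    side-++ (_ ∷ _ ∷ _ ∷ _ ∷ _ ∷ _) (_ ∷ _) (_ ∷ _) _ _ () _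

    -- Shortest words for v, v⁻¹w and w⁻¹u concatenate to a word of length 4 for u, with v and w
    -- among its prefixes.
    side-monotone : ∀ {v w} → Between (Abs N) ε u v → Between (Abs N) ε u w → v ≼ w →
                    side v ≡ side w
    side-monotone {v} {w} v-between w-between v≼w =
      let (rs , v≈) = ℓ-product v
          (ss , v⁻¹w≈) = ℓ-product (v ⁻¹ ∙ w)
          (ts , w⁻¹u≈) = ℓ-product (w ⁻¹ ∙ u)
          w≈ : w ≈ product rs ∙ product ss
          w≈ = D.trans (D.sym (\\-leftDividesˡ v w)) (D.∙-cong v≈ v⁻¹w≈)
          u≈ : u ≈ product rs ∙ (product ss ∙ product ts)
          u≈ = D.trans (D.trans (D.sym (\\-leftDividesˡ w u)) (D.∙-cong w≈ w⁻¹u≈))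
            (D.assoc (product rs) (product ss) (product ts))
      in trans (side-cong v≈) (trans
        (side-++ rs ss ts (proj₁ (length-between v-between)) gap total
          (D.trans u≈ (D.trans (D.∙-congˡ {product rs} (product-++ ss ts))
            (product-++ rs (ss ++ ts)))))
        (sym (side-cong (D.trans w≈ (product-++ rs ss)))))
      where
      open GroupProperties (D N) using (\\-leftDividesˡ)
      w≼u : w ≼ u
      w≼u = proj₁ (proj₂ w-between)
      total : ℓ𝒯 v + (ℓ𝒯 (v ⁻¹ ∙ w) + ℓ𝒯 (w ⁻¹ ∙ u)) ≡ 4
      total = trans (sym (ℕ.+-assoc (ℓ𝒯 v) _ _))
        (trans (cong (_+ ℓ𝒯 (w ⁻¹ ∙ u)) v≼w) (trans w≼u ℓu≡4))
      gap : 0 < ℓ𝒯 (w ⁻¹ ∙ u)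
      gap = ℕ.n≢0⇒n>0 λ p → ℕ.<⇒≢ (proj₂ (length-between w-between))
        (trans (sym (ℕ.+-identityʳ _)) (trans (cong (ℓ𝒯 w +_) (sym p)) w≼u))

    module _ {r₁ r₂ r₃ r₄} (u≈ : u ≈ product (r₁ ∷ r₂ ∷ r₃ ∷ r₄ ∷ [])) where
      private
        prefix : Fin 3 → DPerm N
        prefix 0F = product (r₁ ∷ [])
        prefix 1F = product (r₁ ∷ r₂ ∷ [])
        prefix 2F = product (r₁ ∷ r₂ ∷ r₃ ∷ [])

        -- The prefixes are treated from the longest down: each length found is the hypothesis for
        -- the next shorter one.
        p₃ : ℓ𝒯 (prefix 2F) ≡ 3 × prefix 2F ≼ u
        p₃ = prefix-≼ (r₁ ∷ r₂ ∷ r₃ ∷ []) (r₄ ∷ []) {u}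
          (D.trans (product-++ (r₁ ∷ r₂ ∷ r₃ ∷ []) (r₄ ∷ [])) (D.sym u≈)) ℓu≡4
        p₂ : ℓ𝒯 (prefix 1F) ≡ 2 × prefix 1F ≼ prefix 2F
        p₂ = prefix-≼ (r₁ ∷ r₂ ∷ []) (r₃ ∷ []) {prefix 2F}
          (product-++ (r₁ ∷ r₂ ∷ []) (r₃ ∷ [])) (proj₁ p₃)
        p₁ : ℓ𝒯 (prefix 0F) ≡ 1 × prefix 0F ≼ prefix 1F
        p₁ = prefix-≼ (r₁ ∷ []) (r₂ ∷ []) {prefix 1F}
          (product-++ (r₁ ∷ []) (r₂ ∷ [])) (proj₁ p₂)
        p₁₃ : prefix 0F ≼ prefix 2F
        p₁₃ = ≼-trans {u = prefix 0F} {prefix 1F} {prefix 2F} (proj₂ p₁) (proj₂ p₂)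

        prefix-length : ∀ i → ℓ𝒯 (prefix i) ≡ suc (toℕ i)
        prefix-length 0F = proj₁ p₁
        prefix-length 1F = proj₁ p₂
        prefix-length 2F = proj₁ p₃

        prefix-≼u : ∀ i → prefix i ≼ u
        prefix-≼u 0F = ≼-trans {u = prefix 0F} {prefix 2F} {u} p₁₃ (proj₂ p₃)
        prefix-≼u 1F = ≼-trans {u = prefix 1F} {prefix 2F} {u} (proj₂ p₂) (proj₂ p₃)
        prefix-≼u 2F = proj₂ p₃

        comparable : ∀ i j → Comparable (Abs N) (prefix i) (prefix j)
        comparable 0F 0F = inj₁ (≼-reflexive {u = prefix 0F} {prefix 0F} D.refl)
        comparable 0F 1F = inj₁ (proj₂ p₁)
        comparable 0F 2F = inj₁ p₁₃
        comparable 1F 0F = inj₂ (proj₂ p₁)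
        comparable 1F 1F = inj₁ (≼-reflexive {u = prefix 1F} {prefix 1F} D.refl)
        comparable 1F 2F = inj₁ (proj₂ p₂)
        comparable 2F 0F = inj₂ p₁₃
        comparable 2F 1F = inj₂ (proj₂ p₂)
        comparable 2F 2F = inj₁ (≼-reflexive {u = prefix 2F} {prefix 2F} D.refl)

      prefix-chain : Simplex (orderComplex (Abs N)) 3
      prefix-chain = simplex (Abs N) prefix
        (λ {i} {j} p → Fin.toℕ-injective (ℕ.suc-injective
          (trans (sym (prefix-length i)) (trans (ℓ-cong p) (prefix-length j)))))
        comparable

      prefix-between : ∀ i → Between (Abs N) ε u (vertex prefix-chain i)
      prefix-between i = Between-length {u = u} {prefix i} (prefix-≼u i)
        (subst (0 <_) (sym (prefix-length i)) (s≤s z≤n))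
        (subst₂ _<_ (sym (prefix-length i)) (sym ℓu≡4) (s≤s (Fin.toℕ<n i)))

    -- Lengths strictly inside the interval are 1, 2 or 3, and comparable elements of equal length
    -- coincide.
    between-dimension : ∀ m (σ : Simplex (orderComplex (Abs N)) m) →
      (∀ i → Between (Abs N) ε u (vertex σ i)) → m ≤ 3
    between-dimension m σ between = Fin.injective⇒≤ {f = rank} λ {i} {j} p →
      distinct σ (equal (vertices-comparable (Abs N) σ i j) (rank-injective p))
      where
      len : Fin m → ℕ
      len i = ℓ𝒯 (vertex σ i)
      0<len : ∀ i → 0 < len i
      0<len i = proj₁ (length-between (between i))
      rank<3 : ∀ i → pred (len i) < 3
      rank<3 i = ℕ.pred-mono-< {{>-nonZero (0<len i)}}
        (subst (len i <_) ℓu≡4 (proj₂ (length-between (between i))))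
      rank : Fin m → Fin 3
      rank i = fromℕ< (rank<3 i)
      rank-injective : ∀ {i j} → rank i ≡ rank j → len i ≡ len j
      rank-injective {i} {j} p = ℕ.pred-injective {{>-nonZero (0<len i)}} {{>-nonZero (0<len j)}}
        (trans (sym (Fin.toℕ-fromℕ< (rank<3 i))) (trans (cong toℕ p) (Fin.toℕ-fromℕ< (rank<3 j))))
      equal : ∀ {v w} → Comparable (Abs N) v w → ℓ𝒯 v ≡ ℓ𝒯 w → v ≈ w
      equal {v} {w} (inj₁ v≼w) p = ≼-length-injective {v = v} {w} v≼w p
      equal {v} {w} (inj₂ w≼v) p = D.sym (≼-length-injective {v = w} {v} w≼v (sym p))

    Abs-¬CohenMacaulay : (k : HeytingField c ℓ₁ ℓ₂) → ¬ CohenMacaulay k (Abs N)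
    Abs-¬CohenMacaulay = split-interval⇒¬CohenMacaulay (Abs N) {x = ε} {y = u} ε-≼
      ((N + N) ^ N) Abs-bounded 3 (s≤s (s≤s z≤n))
      (prefix-chain u≈word₁₂∣₃₄) (prefix-between u≈word₁₂∣₃₄) between-dimension
      side (λ {v} {w} → side-monotone {v} {w})
      -- ((1,2)) and ((1,3)) begin the two words for u and lie on different sides.
      (product (t₁₂ Sign.+ ∷ [])) (product (t₁₃ Sign.+ ∷ []))
      (prefix-between u≈word₁₂∣₃₄ 0F) (prefix-between u≈word₁₃∣₂₄ 0F) side-t₁₂ side-t₁₃

    -- The order on the closed interval is pulled back along the first projection, so betweenness
    -- and `side` carry over from the whole poset.
    interval-¬CohenMacaulay : (k : HeytingField c ℓ₁ ℓ₂) →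
      ¬ CohenMacaulay k (closedInterval (Abs N) ε u)
    interval-¬CohenMacaulay = split-interval⇒¬CohenMacaulay I {x = bottom} {y = top}
      (λ (_ , ε≼z , _) → ε≼z)
      ((N + N) ^ N) (λ m → Abs-bounded m ∘ forget) 3 (s≤s (s≤s z≤n))
      (simplex I (inside ∘ prefix-between u≈word₁₂∣₃₄)
        (λ {i} {j} → distinct (prefix-chain u≈word₁₂∣₃₄) {i} {j})
        (vertices-comparable (Abs N) (prefix-chain u≈word₁₂∣₃₄)))
      (prefix-between u≈word₁₂∣₃₄) (λ m σ → between-dimension m (forget σ))
      (side ∘ proj₁) (λ {v} {w} → side-monotone {proj₁ v} {proj₁ w})
      (inside (prefix-between u≈word₁₂∣₃₄ 0F)) (inside (prefix-between u≈word₁₃∣₂₄ 0F))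
      (prefix-between u≈word₁₂∣₃₄ 0F) (prefix-between u≈word₁₃∣₂₄ 0F) side-t₁₂ side-t₁₃
      where
      I = closedInterval (Abs N) ε u
      bottom top : ∃ λ z → ε ≼ z × z ≼ u
      bottom = ε , ≼-reflexive {u = ε} {ε} D.refl , ε-≼ u
      top    = u , ε-≼ u , ≼-reflexive {u = u} {u} D.refl
      inside : ∀ {v} → Between (Abs N) ε u v → ∃ λ z → ε ≼ z × z ≼ u
      inside {v} ((ε≼v , _) , (v≼u , _)) = v , ε≼v , v≼u
      forget : ∀ {m} → Simplex (orderComplex I) m → Simplex (orderComplex (Abs N)) m
      forget σ = simplex (Abs N) (proj₁ ∘ vertex σ)
        (λ {i} {j} → distinct σ {i} {j}) (vertices-comparable I σ)

    -- `side` is constant along covers and along equal elements, hence along paths.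
    interval-disconnected : HasseDisconnected (openInterval (Abs N) ε u)
    interval-disconnected =
      (_ , prefix-between u≈word₁₂∣₃₄ 0F) , (_ , prefix-between u≈word₁₃∣₂₄ 0F) ,
      λ joined → contradiction (trans (sym side-t₁₂) (trans (connected joined) side-t₁₃)) λ ()
      where
      connected : ∀ {x y} → Joined (openInterval (Abs N) ε u) x y → side (proj₁ x) ≡ side (proj₁ y)
      connected = EqClosure.gfold isEquivalence (side ∘ proj₁) λ where
        (inj₁ x≈y) → side-cong x≈y
        {_ , x-between} {_ , y-between} (inj₂ ((x≼y , _) , _)) →
          side-monotone x-between y-between x≼y

-- Specialisation to D₄ and to Dₙ with n ≥ 4

u₄-negates : NegatesFirst {4} {0} u₄
u₄-negates = record
  { negates = λ { 0F → refl ; 1F → refl ; 2F → refl ; 3F → refl }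
  ; fixes   = λ () }

mainTheorem4 : (c ℓ₁ ℓ₂ : Level) →
    HasseDisconnected (openInterval (Abs 4) e₄ u₄)
    × ((k : HeytingField c ℓ₁ ℓ₂) → ¬ CohenMacaulay k (closedInterval (Abs 4) e₄ u₄))
    × ((n : ℕ) → 4 ≤ n → (k : HeytingField c ℓ₁ ℓ₂) → ¬ CohenMacaulay k (Abs n))
mainTheorem4 c ℓ₁ ℓ₂ =
  interval-disconnected u₄-negates ,
  interval-¬CohenMacaulay u₄-negates ,
  -- Matching on 4 ≤ n turns n into 4 + n′; there the word for ((1,±2)), ((3,±4)) plays the part of
  -- u.
  λ { _ (s≤s (s≤s (s≤s (s≤s (z≤n {n}))))) → Abs-¬CohenMacaulay (word-negates {n}) }
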